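{- Let $(X,d)$ be a geodesic space. Then the following are equivalent: (1) Every unit ball graph on $X$ is strongly chordal. (2) Every unit ball graph on $X$ is chordal. (3) $X$ is an $\mathbb{R}$-tree.
   Context: All graphs are finite, simple and undirected. Geodesic space: let $(X,d)$ be a metric space. A geodesic from $x$ to $y$ is a distance-preserving map $\gamma\colon[0,d(x,y)]\to X$ with $\gamma(0)=x$, $\gamma(d(x,y))=y$; $(X,d)$ is a geodesic space if every two points are joined by a geodesic. Unit ball graph: a graph $G=(V_G,E_G)$ is a unit ball graph on $(X,d)$ if there exist $\delta>0$ (threshold) and a map $\rho\colon V_G\to X$ (realization, not required to be injective) such that for distinct $u,v\in V_G$, $\{u,v\}\in E_G$ if and only if $d(\rho(u),\rho(v))\le\delta$. Chordal: a graph is chordal if for every $n\ge4$ it has no induced subgraph isomorphic to the cycle $C_n$. Sun: for $n\ge3$, the $n$-sun is the graph on $2n$ vertices $\{v_i : i\in\mathbb{Z}/2n\mathbb{Z}\}$ such that the even-indexed vertices induce a complete graph, the odd-indexed vertices form an independent set, and an odd-indexed $v_i$ is adjacent to an even-indexed $v_j$ if and only if $i-j=\pm1$. A graph is sun-free if for every $n\ge3$ it has no induced subgraph isomorphic to the $n$-sun. Strongly chordal: chordal and sun-free. $\mathbb{R}$-tree: a geodesic space that is uniquely arc-connected, i.e. every pair of points in it is joined by a unique arc (an arc is the image of a topological embedding of a closed interval). -}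

module Defs where

open import Algebra.Bundles using (CommutativeRing)
open import Algebra.Structures using (IsCommutativeRing)
import Algebra.Construct.NaturalChoice.Max as Max
open import Data.Fin.Base using (Fin; toℕ)
open import Data.Fin.Properties using (nonZeroIndex)
open import Data.Nat.Base as ℕ using (ℕ)
open import Data.Nat.Divisibility using (_∣_; _∤_)
open import Data.Nat.DivMod using (_%_)
open import Data.Product using (∃; ∃-syntax; ∃!; _×_; _,_; proj₁)
open import Data.Sum.Base using (_⊎_; inj₁; inj₂; swap)
open import Function.Bundles using (_⇔_; _⟶ₛ_; module Func)
open import Function.Definitions using (Injective)
open import Function.Metric.Structures using (IsGeneralMetric)
open import Level using (Level; 0ℓ; _⊔_) renaming (suc to lsuc)
open import Relation.Binary.Bundles using (Setoid; TotalOrder)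
open import Relation.Binary.Core using (Rel)
open import Relation.Binary.Definitions using (Symmetric; Irreflexive)
import Relation.Binary.Construct.NonStrictToStrict as Strict
import Relation.Binary.Construct.On as On
open import Relation.Binary.PropositionalEquality.Core using (_≡_; _≢_; refl; ≢-sym)
open import Relation.Binary.Structures using (IsTotalOrder)
open import Relation.Nullary.Negation using (¬_)
open import Relation.Unary using (Pred; _≐_)

------------------------------------------------------------------------
-- The real numbers

-- The real numbers are specified, up to isomorphism, as a complete
-- ordered field.  Under excluded middle it is no restriction that `sup`
-- only quantifies over predicates in the lowest universe.

record CompleteOrderedField : Set₁ where
  infix  4 _≈_ _≤_
  infixl 7 _*_
  infixl 6 _+_
  infix  8 -_
  field
    Carrier           : Set
    _≈_               : Rel Carrier 0ℓ
    _≤_               : Rel Carrier 0ℓ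
    _+_ _*_           : Carrier → Carrier → Carrier
    -_                : Carrier → Carrier
    0# 1#             : Carrier
    isCommutativeRing : IsCommutativeRing _≈_ _+_ _*_ -_ 0# 1#
    0≉1               : ¬ (0# ≈ 1#)
    inverse           : ∀ x → ¬ (x ≈ 0#) → ∃[ y ] x * y ≈ 1#
    isTotalOrder      : IsTotalOrder _≈_ _≤_
    +-monoˡ-≤         : ∀ {x y} z → x ≤ y → x + z ≤ y + z
    *-nonNegative     : ∀ {x y} → 0# ≤ x → 0# ≤ y → 0# ≤ x * y

  UpperBound : Pred Carrier 0ℓ → Pred Carrier 0ℓ
  UpperBound P u = ∀ x → P x → x ≤ u

  field
    sup : ∀ (P : Pred Carrier 0ℓ) → ∃ P → ∃ (UpperBound P) →
          ∃[ s ] UpperBound P s × (∀ u → UpperBound P u → s ≤ u)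

  commutativeRing : CommutativeRing 0ℓ 0ℓ
  commutativeRing = record { isCommutativeRing = isCommutativeRing }

  totalOrder : TotalOrder 0ℓ 0ℓ 0ℓ
  totalOrder = record { isTotalOrder = isTotalOrder }

  open CommutativeRing commutativeRing public using (_-_; setoid)
  open Max totalOrder public using () renaming (_⊔_ to max)
  open Strict _≈_ _≤_ public using (_<_)

  ∣_∣ : Carrier → Carrier
  ∣ x ∣ = max x (- x)

  Interval : Carrier → Carrier → Set
  Interval a b = ∃[ t ] a ≤ t × t ≤ b

  intervalSetoid : Carrier → Carrier → Setoid 0ℓ 0ℓ
  intervalSetoid a b = On.setoid {B = Interval a b} setoid proj₁

  dist : ∀ {a b} → Interval a b → Interval a b → Carrier
  dist (s , _) (t , _) = ∣ s - t ∣

  left : ∀ {a b} → a ≤ b → Interval a b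
  left a≤b = _ , IsTotalOrder.refl isTotalOrder , a≤b

  right : ∀ {a b} → a ≤ b → Interval a b
  right a≤b = _ , a≤b , IsTotalOrder.refl isTotalOrder

------------------------------------------------------------------------
-- Metric spaces

record MetricSpace (ℝ : CompleteOrderedField) (c ℓ : Level) : Set (lsuc (c ⊔ ℓ)) where
  private module R = CompleteOrderedField ℝ
  infix 4 _≈_
  field
    Carrier  : Set c
    _≈_      : Rel Carrier ℓ
    d        : Carrier → Carrier → R.Carrier
    isMetric : IsGeneralMetric _≈_ R._≈_ R._≤_ R.0# R._+_ d

  open IsGeneralMetric isMetric public
    using (nonNegative; triangle; ≈⇒0; 0⇒≈; sym; cong; ≈-isEquivalence)

  setoid : Setoid c ℓ
  setoid = record { isEquivalence = ≈-isEquivalence }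

module _ {ℝ : CompleteOrderedField} {c ℓ : Level} (X : MetricSpace ℝ c ℓ) where
  open CompleteOrderedField ℝ
    using (_≤_; _<_; 0#; Interval; intervalSetoid; dist; left; right)
    renaming (Carrier to R; _≈_ to _≈ᵣ_)
  open MetricSpace X using (Carrier; _≈_; d; nonNegative; setoid)

  record Geodesic (x y : Carrier) : Set (c ⊔ ℓ) where
    field
      γ                  : intervalSetoid 0# (d x y) ⟶ₛ setoid
      distancePreserving : ∀ s t → d (Func.to γ s) (Func.to γ t) ≈ᵣ dist s t
      start              : Func.to γ (left nonNegative) ≈ x
      end                : Func.to γ (right nonNegative) ≈ y

  IsGeodesicSpace : Set (c ⊔ ℓ)
  IsGeodesicSpace = ∀ x y → Geodesic x y

  record IsEmbedding {a b : R} (f : intervalSetoid a b ⟶ₛ setoid) : Set ℓ where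
    open Func f using (to)
    field
      injective         : ∀ s t → to s ≈ to t → proj₁ s ≈ᵣ proj₁ t
      continuous        : ∀ s ε → 0# < ε → ∃[ η ] 0# < η ×
                          (∀ t → dist s t < η → d (to s) (to t) < ε)
      inverseContinuous : ∀ s ε → 0# < ε → ∃[ η ] 0# < η ×
                          (∀ t → d (to s) (to t) < η → dist s t < ε)

  -- The parameter interval may be degenerate, so that the singleton {x}
  -- is the arc from x to itself.
  record IsArc (x y : Carrier) (A : Pred Carrier ℓ) : Set (c ⊔ ℓ) where
    field
      {a b}       : R
      a≤b         : a ≤ b
      f           : intervalSetoid a b ⟶ₛ setoid
      isEmbedding : IsEmbedding f
      start       : Func.to f (left a≤b) ≈ x
      end         : Func.to f (right a≤b) ≈ y
      isImage     : A ≐ λ p → ∃[ t ] Func.to f t ≈ p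

  IsUniquelyArcConnected : Set (c ⊔ lsuc ℓ)
  IsUniquelyArcConnected = ∀ x y → ∃! _≐_ (IsArc x y)

  IsRTree : Set (c ⊔ lsuc ℓ)
  IsRTree = IsGeodesicSpace × IsUniquelyArcConnected

------------------------------------------------------------------------
-- Graphs

record Graph : Set₁ where
  field
    order  : ℕ
    Edge   : Rel (Fin order) 0ℓ
    symm   : Symmetric Edge
    irrefl : Irreflexive _≡_ Edge

  Vertex : Set
  Vertex = Fin order

-- An isomorphism from H onto the subgraph of G induced by the range of f.
record InducedCopy (H G : Graph) : Set where
  private
    module H = Graph H
    module G = Graph G
  field
    f         : H.Vertex → G.Vertex
    injective : Injective _≡_ _≡_ f
    edges     : ∀ u v → H.Edge u v ⇔ G.Edge (f u) (f v)

-- j = i + 1 in ℤ/nℤ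
Next : ∀ {n} → Rel (Fin n) 0ℓ
Next {n} i j = (ℕ.suc (toℕ i) % n) {{nonZeroIndex i}} ≡ toℕ j

-- i - j = ±1 in ℤ/nℤ
Neighbours : ∀ {n} → Rel (Fin n) 0ℓ
Neighbours i j = Next i j ⊎ Next j i

-- The cycle Cₙ, for n ≥ 3.
cycle : ℕ → Graph
cycle n = record
  { order  = n
  ; Edge   = λ i j → i ≢ j × Neighbours i j
  ; symm   = λ (i≢j , e) → ≢-sym i≢j , swap e
  ; irrefl = λ i≡j (i≢j , _) → i≢j i≡j
  }

Even Odd : ∀ {n} → Pred (Fin n) 0ℓ
Even i = 2 ∣ toℕ i
Odd  i = 2 ∤ toℕ i

data SunEdge {n} (i j : Fin (2 ℕ.* n)) : Set where
  even-even : i ≢ j → Even i → Even j → SunEdge i j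
  odd-even  : Odd i → Even j → Neighbours i j → SunEdge i j
  even-odd  : Even i → Odd j → Neighbours i j → SunEdge i j

-- The n-sun, for n ≥ 3.
sun : ℕ → Graph
sun n = record
  { order  = 2 ℕ.* n
  ; Edge   = SunEdge {n}
  ; symm   = λ where
      (even-even i≢j ei ej) → even-even (≢-sym i≢j) ej ei
      (odd-even oi ej e)    → even-odd ej oi (swap e)
      (even-odd ei oj e)    → odd-even oj ei (swap e)
  ; irrefl = λ where
      refl (even-even i≢i _ _) → i≢i refl
      refl (odd-even oi ei _)  → oi ei
      refl (even-odd ei oi _)  → oi ei
  }

Chordal : Graph → Set
Chordal G = ∀ n → 4 ℕ.≤ n → ¬ InducedCopy (cycle n) G

SunFree : Graph → Set
SunFree G = ∀ n → 3 ℕ.≤ n → ¬ InducedCopy (sun n) G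

StronglyChordal : Graph → Set
StronglyChordal G = Chordal G × SunFree G

record IsUnitBallGraph {ℝ c ℓ} (X : MetricSpace ℝ c ℓ) (G : Graph) : Set c where
  open CompleteOrderedField ℝ using (_≤_; _<_; 0#) renaming (Carrier to R)
  open MetricSpace X using (Carrier; d)
  open Graph G using (Vertex; Edge)
  field
    δ     : R
    0<δ   : 0# < δ
    ρ     : Vertex → Carrier
    edges : ∀ u v → u ≢ v → Edge u v ⇔ d (ρ u) (ρ v) ≤ δ

{-# OPTIONS --safe #-}
module Submission where

-- In a uniquely arc-connected geodesic space two geodesics from a point w
-- share exactly an initial segment, and following one back to the
-- branching point and the other one from there on is an arc, hence the
-- geodesic between their ends.  This gives the four-point condition.
-- Under it, a vertex furthest from a root is simplicial, so that there is
-- no induced cycle; and the neighbours of an odd vertex of a sun furthest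
-- from a root have nested neighbourhoods among the odd vertices, which
-- fails in a sun.
--
-- Conversely, let m lie on a geodesic from x to y, and suppose that a
-- path from x to y avoids the ball of radius 2δ around m.  Walking in
-- steps of length at most δ from the point at distance δ from m towards x
-- to x, along the path to y, and back towards m closes up through m to an
-- induced cycle of length at least 4, once shortened to an induced path.
-- So if all unit ball graphs are chordal then every arc from x to y
-- contains the geodesic, and by continuity it cannot contain more.

open import Defs
open import Algebra.Bundles using (CommutativeRing)
import Algebra.Construct.NaturalChoice.Max as Max
import Algebra.Properties.AbelianGroup as AbelianGroupProperties
import Algebra.Properties.Ring as RingProperties
import Algebra.Solver.Ring.NaturalCoefficients.Default as SemiringSolver
open import Axiom.ExcludedMiddle using (ExcludedMiddle)
open import Data.Fin.Base using (Fin; zero; suc; toℕ; fromℕ; fromℕ<; inject₁)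
open import Data.Fin.Properties using (toℕ-injective; toℕ-fromℕ; toℕ-fromℕ<; toℕ-inject₁; toℕ<n)
open import Data.List.Base using (filter; allFin)
import Data.List.Extrema as Extrema
open import Data.List.Membership.Propositional.Properties using (∈-filter⁺; ∈-allFin)
import Data.List.Relation.Unary.All as List
open import Data.List.Relation.Unary.All.Properties using (all-filter)
open import Data.Nat.Base as ℕ using (ℕ)
open import Data.Nat.Divisibility using (_∣_; _∤_; divides; ∣m+n∣m⇒∣n; ∣m∣n⇒∣m+n; ∣n⇒∣m*n; ∣⇒≤; ∣1⇒≡1)
open import Data.Nat.DivMod using (_/_; _%_; m≡m%n+[m/n]*n; m%n<n; m<n⇒m%n≡m; n%n≡0)
import Data.Nat.Properties as ℕ
open import Data.Nat.Solver using (module +-*-Solver)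
open import Data.Product using (∃; ∃-syntax; _×_; _,_; proj₁; proj₂)
open import Data.Sum.Base using (_⊎_; inj₁; inj₂; swap)
open import Data.Unit.Base using (tt)
open import Data.Vec.Base using (Vec; []; _∷_; lookup)
open import Data.Vec.Relation.Unary.All using (All; []; _∷_)
open import Data.Vec.Relation.Unary.All.Properties using (lookup⁺)
open import Data.Vec.Relation.Unary.Any using (Any; here; there)
open import Function.Base using (_∘_; case_of_; id)
open import Function.Bundles using (Func; _⟶ₛ_; _⇔_; mk⇔; Equivalence)
open import Level using (0ℓ)
open import Relation.Binary.Bundles using (Setoid; TotalOrder)
open import Relation.Binary.Construct.Closure.ReflexiveTransitive
  using (Star; _◅_; _◅◅_; reverse) renaming (ε to stop)
open import Relation.Binary.Core using (Rel)
open import Relation.Binary.Definitions using (tri<; tri≈; tri>)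
import Relation.Binary.Properties.TotalOrder as TotalOrderProperties
open import Relation.Binary.PropositionalEquality as ≡ using (_≡_; _≢_; refl; ≢-sym)
open import Relation.Nullary.Decidable using (Dec; yes; no; True; toWitness; fromWitness; decidable-stable)
open import Relation.Nullary.Negation using (¬_; contradiction)
open import Relation.Unary using (Pred)

-- Real numbers

module Reals (em : ∀ {ℓ} → ExcludedMiddle ℓ) (ℝ : CompleteOrderedField) where
  open CompleteOrderedField ℝ public
  open CommutativeRing commutativeRing public
    using (+-cong; +-congˡ; +-congʳ; +-comm; +-assoc; +-identityˡ; +-identityʳ; -‿inverseˡ; -‿inverseʳ;
      distribʳ; *-identityˡ; *-congʳ;
      +-abelianGroup; ring; commutativeSemiring)
  open TotalOrder totalOrder public
    using (≤-respˡ-≈; ≤-respʳ-≈)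
    renaming (refl to ≤-refl; reflexive to ≤-reflexive; trans to ≤-trans; antisym to ≤-antisym; total to ≤-total;
      module Eq to ≈)
  open Max totalOrder using (x≤y⇒x⊔y≈y; x≤y⇒y⊔x≈y)
  open TotalOrderProperties totalOrder public using (≰⇒>; <⇒≱)
  open SemiringSolver commutativeSemiring public
    using (solve; _:+_; _:=_; con; Polynomial)

  byContradiction : ∀ {p} {P : Set p} → ¬ ¬ P → P
  byContradiction = decidable-stable em

  ≮⇒≥ : ∀ {x y} → ¬ (x < y) → y ≤ x
  ≮⇒≥ x≮y = byContradiction (x≮y ∘ ≰⇒>)

  infixl 6 _⊕_
  _⊕_ : ∀ {a b c d} → a ≤ b → c ≤ d → a + c ≤ b + d
  _⊕_ {a} {b} {c} {d} a≤b c≤d = ≤-trans (+-monoˡ-≤ c a≤b)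
    (≤-respˡ-≈ (+-comm c b) (≤-respʳ-≈ (+-comm d b) (+-monoˡ-≤ b c≤d)))

  cancelʳ : ∀ {x y} z → x + z ≤ y + z → x ≤ y
  cancelʳ {x} {y} z h = ≤-respˡ-≈ (undo x) (≤-respʳ-≈ (undo y) (+-monoˡ-≤ (- z) h))
    where
    undo : ∀ w → w + z + - z ≈ w
    undo w = ≈.trans (+-assoc w z (- z)) (≈.trans (+-congˡ (-‿inverseʳ z)) (+-identityʳ w))

  -- An inequality x ≤ y follows from a sum a ≤ b of
  -- hypotheses when y - x = b - a; stated without subtraction, so that
  -- the semiring solver applies.
  linear : ∀ {x y a b} → a ≤ b → x + b ≈ y + a → x ≤ y
  linear {x} {y} {a} {b} a≤b eq =
    cancelʳ b (≤-respˡ-≈ (≈.sym eq) (≤-respˡ-≈ (+-comm a y) (≤-respʳ-≈ (+-comm b y) (a≤b ⊕ ≤-refl {y}))))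

  x+[y-x]≈y : ∀ x y → x + (y - x) ≈ y
  x+[y-x]≈y x y = ≈.trans (+-comm x (y - x))
    (≈.trans (+-assoc y (- x) x) (≈.trans (+-congˡ (-‿inverseˡ x)) (+-identityʳ y)))

  -- `hypotheses ⊢ goal` is the identity that `linear` asks for, where
  -- hypotheses are added with ⊞ as their proofs are with ⊕.
  infix  5 _:≤_
  infixl 4 _⊞_
  infix  3 _⊢_

  _:≤_ : ∀ {n} → Polynomial n → Polynomial n → Polynomial n × Polynomial n
  _:≤_ = _,_

  _⊞_ : ∀ {n} → Polynomial n × Polynomial n → Polynomial n × Polynomial n → Polynomial n × Polynomial n
  (p , q) ⊞ (p′ , q′) = p :+ p′ , q :+ q′

  _⊢_ : ∀ {n} → Polynomial n × Polynomial n → Polynomial n × Polynomial n → Polynomial n × Polynomial n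
  (a , b) ⊢ (x , y) = x :+ b := y :+ a

  :0 : ∀ {n} → Polynomial n
  :0 = con 0

  0≤1 : 0# ≤ 1#
  0≤1 with ≤-total 0# 1#
  ... | inj₁ 0≤1 = 0≤1
  ... | inj₂ 1≤0 = ≤-respʳ-≈ -1*-1≈1 (*-nonNegative 0≤-1 0≤-1)
    where
    open RingProperties ring
    0≤-1 : 0# ≤ - 1#
    0≤-1 = ≤-respˡ-≈ (-‿inverseʳ 1#) (≤-respʳ-≈ (+-identityˡ (- 1#)) (+-monoˡ-≤ (- 1#) 1≤0))
    -1*-1≈1 : - 1# * - 1# ≈ 1#
    -1*-1≈1 = ≈.trans (-1*x≈-x (- 1#)) (-‿involutive 1#)

  half-exists : ∀ x → ∃[ y ] y + y ≈ x
  half-exists x with inverse (1# + 1#) 1+1≉0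
    where
    1+1≉0 : ¬ (1# + 1# ≈ 0#)
    1+1≉0 eq = 0≉1 (≤-antisym 0≤1 (linear (0≤1 ⊕ ≤-reflexive eq)
      (solve 1 (λ i → (:0 :≤ i) ⊞ (i :+ i :≤ :0) ⊢ i :≤ :0) ≈.refl _)))
  ... | h , 2h≈1 = h * x , ≈.trans (≈.sym (distribʳ x h h)) (≈.trans (*-congʳ h+h≈1) (*-identityˡ x))
    where
    h+h≈1 : h + h ≈ 1#
    h+h≈1 = ≈.trans (≈.sym (≈.trans (distribʳ h 1# 1#) (+-cong (*-identityˡ h) (*-identityˡ h)))) 2h≈1

  half : Carrier → Carrier
  half x = proj₁ (half-exists x)

  half+half : ∀ x → half x + half x ≈ x
  half+half x = proj₂ (half-exists x)

  0<half : ∀ {x} → 0# < x → 0# < half x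
  0<half {x} 0<x = ≰⇒> λ h≤0 → <⇒≱ 0<x (linear (h≤0 ⊕ h≤0 ⊕ ≤-reflexive (≈.sym (half+half x)))
    (solve 2 (λ x h → (h :≤ :0) ⊞ (h :≤ :0) ⊞ (x :≤ h :+ h) ⊢ x :≤ :0) ≈.refl _ _))

  [t-s]≤[s-t] : ∀ {s t} → t ≤ s → t - s ≤ s - t
  [t-s]≤[s-t] {s} {t} t≤s =
    linear (t≤s ⊕ t≤s ⊕ ≤-reflexive (≈.sym (x+[y-x]≈y t s)) ⊕ ≤-reflexive (x+[y-x]≈y s t))
      (solve 4 (λ s t z n → (t :≤ s) ⊞ (t :≤ s) ⊞ (s :≤ t :+ z) ⊞ (s :+ n :≤ t) ⊢ n :≤ z) ≈.refl s t _ _)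

  ∣-∣-cases : ∀ s t → (t ≤ s × t + ∣ s - t ∣ ≈ s) ⊎ (s ≤ t × s + ∣ s - t ∣ ≈ t)
  ∣-∣-cases s t = case ≤-total t s of λ where
      (inj₁ t≤s) → inj₁ (t≤s , ≈.trans (+-congˡ (x≤y⇒y⊔x≈y (≤-respˡ-≈ (≈.sym flip) ([t-s]≤[s-t] t≤s)))) (x+[y-x]≈y t s))
      (inj₂ s≤t) → inj₂ (s≤t , ≈.trans (+-congˡ (≈.trans (x≤y⇒x⊔y≈y (≤-respʳ-≈ (≈.sym flip) ([t-s]≤[s-t] s≤t))) flip))
        (x+[y-x]≈y s t))
    where
    flip : - (s - t) ≈ t - s
    flip = AbelianGroupProperties.⁻¹-anti-homo‿- +-abelianGroup s t

  ∣-∣≤ : ∀ {s t r} → s ≤ t + r → t ≤ s + r → ∣ s - t ∣ ≤ r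
  ∣-∣≤ {s} {t} s≤t+r t≤s+r with ∣-∣-cases s t
  ... | inj₁ (_ , eq) = linear (s≤t+r ⊕ ≤-reflexive eq)
    (solve 4 (λ s t r z → (s :≤ t :+ r) ⊞ (t :+ z :≤ s) ⊢ z :≤ r) ≈.refl _ _ _ _)
  ... | inj₂ (_ , eq) = linear (t≤s+r ⊕ ≤-reflexive eq)
    (solve 4 (λ s t r z → (s :≤ t :+ r) ⊞ (t :+ z :≤ s) ⊢ z :≤ r) ≈.refl _ _ _ _)

  ≤+∣-∣ : ∀ s t → s ≤ t + ∣ s - t ∣
  ≤+∣-∣ s t with ∣-∣-cases s t
  ... | inj₁ (_ , eq) = ≤-reflexive (≈.sym eq)
  ... | inj₂ (s≤t , eq) = linear (s≤t ⊕ s≤t ⊕ ≤-reflexive (≈.sym eq))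
    (solve 3 (λ s t z → (s :≤ t) ⊞ (s :≤ t) ⊞ (t :≤ s :+ z) ⊢ s :≤ t :+ z) ≈.refl _ _ _)

  ≤+∣-∣′ : ∀ s t → t ≤ s + ∣ s - t ∣
  ≤+∣-∣′ s t with ∣-∣-cases s t
  ... | inj₂ (_ , eq) = ≤-reflexive (≈.sym eq)
  ... | inj₁ (t≤s , eq) = linear (t≤s ⊕ t≤s ⊕ ≤-reflexive (≈.sym eq))
    (solve 3 (λ s t z → (s :≤ t) ⊞ (s :≤ t) ⊞ (t :≤ s :+ z) ⊢ s :≤ t :+ z) ≈.refl _ _ _)

  ∣-∣-sym : ∀ s t → ∣ s - t ∣ ≈ ∣ t - s ∣
  ∣-∣-sym s t = ≤-antisym (∣-∣≤ (≤+∣-∣′ t s) (≤+∣-∣ t s)) (∣-∣≤ (≤+∣-∣′ s t) (≤+∣-∣ s t))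

  s≤t⇒s+∣s-t∣≈t : ∀ {s t} → s ≤ t → s + ∣ s - t ∣ ≈ t
  s≤t⇒s+∣s-t∣≈t {s} {t} s≤t with ∣-∣-cases s t
  ... | inj₂ (_ , eq) = eq
  ... | inj₁ (_ , eq) = ≤-antisym
    (linear (s≤t ⊕ s≤t ⊕ ≤-reflexive eq)
      (solve 3 (λ s t z → (s :≤ t) ⊞ (s :≤ t) ⊞ (t :+ z :≤ s) ⊢ s :+ z :≤ t) ≈.refl _ _ _))
    (≤+∣-∣′ s t)

  -- The hypothesis compares the two differences without subtraction, within reach of the semiring
  -- solver.
  ∣-∣-cong : ∀ {s t u v} → s + v ≈ t + u → ∣ s - t ∣ ≈ ∣ u - v ∣
  ∣-∣-cong eq = ≤-antisym (shift≤ eq) (shift≤ (≈.trans (+-comm _ _) (≈.trans (≈.sym eq) (+-comm _ _))))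
    where
    shift≤ : ∀ {s t u v} → s + v ≈ t + u → ∣ s - t ∣ ≤ ∣ u - v ∣
    shift≤ {s} {t} {u} {v} eq = ∣-∣≤
      (linear (≤-reflexive eq ⊕ ≤+∣-∣ u v) (step _ _ _ _ _))
      (linear (≤-reflexive (≈.sym eq) ⊕ ≤+∣-∣′ u v) (step _ _ _ _ _))
      where
      step = solve 5 (λ s t u v a → (s :+ v :≤ t :+ u) ⊞ (u :≤ v :+ a) ⊢ s :≤ t :+ a) ≈.refl

  ∣-∣≤0⇒≈ : ∀ {s t} → ∣ s - t ∣ ≤ 0# → s ≈ t
  ∣-∣≤0⇒≈ {s} {t} z≤0 = ≤-antisym (linear (≤+∣-∣ s t ⊕ z≤0) (step _ _ _)) (linear (≤+∣-∣′ s t ⊕ z≤0) (step _ _ _))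
    where step = solve 3 (λ s t z → (s :≤ t :+ z) ⊞ (z :≤ :0) ⊢ s :≤ t) ≈.refl

  ∣-∣< : ∀ {s t r} → s < t + r → t < s + r → ∣ s - t ∣ < r
  ∣-∣< {s} {t} s<t+r t<s+r = ≰⇒> λ r≤ → case ∣-∣-cases s t of λ where
    (inj₁ (_ , eq)) → <⇒≱ s<t+r (linear (r≤ ⊕ ≤-reflexive eq)
      (solve 4 (λ s t r z → (r :≤ z) ⊞ (t :+ z :≤ s) ⊢ t :+ r :≤ s) ≈.refl _ _ _ _))
    (inj₂ (_ , eq)) → <⇒≱ t<s+r (linear (r≤ ⊕ ≤-reflexive eq)
      (solve 4 (λ s t r z → (r :≤ z) ⊞ (t :+ z :≤ s) ⊢ t :+ r :≤ s) ≈.refl _ _ _ _))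

  ∣-∣<⇒<+ : ∀ {s t r} → ∣ s - t ∣ < r → s < t + r
  ∣-∣<⇒<+ {s} {t} lt = ≰⇒> λ t+r≤s → <⇒≱ lt (linear (t+r≤s ⊕ ≤+∣-∣ s t)
    (solve 4 (λ s t r z → (t :+ r :≤ s) ⊞ (s :≤ t :+ z) ⊢ r :≤ z) ≈.refl _ _ _ _))

  ∣-∣<⇒<+′ : ∀ {s t r} → ∣ s - t ∣ < r → t < s + r
  ∣-∣<⇒<+′ {s} {t} lt = ≰⇒> λ s+r≤t → <⇒≱ lt (linear (s+r≤t ⊕ ≤+∣-∣′ s t)
    (solve 4 (λ s t r z → (s :+ r :≤ t) ⊞ (t :≤ s :+ z) ⊢ r :≤ z) ≈.refl _ _ _ _))

  ≤-<-trans : ∀ {x y z} → x ≤ y → y < z → x < z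
  ≤-<-trans x≤y y<z = ≰⇒> λ z≤x → <⇒≱ y<z (≤-trans z≤x x≤y)

  <-≤-trans : ∀ {x y z} → x < y → y ≤ z → x < z
  <-≤-trans x<y y≤z = ≰⇒> λ z≤x → <⇒≱ x<y (≤-trans y≤z z≤x)

  minimum : ∀ {x y} → 0# < x → 0# < y → ∃[ z ] 0# < z × z ≤ x × z ≤ y
  minimum {x} {y} 0<x 0<y = case ≤-total x y of λ where
    (inj₁ x≤y) → x , 0<x , ≤-refl , x≤y
    (inj₂ y≤x) → y , 0<y , y≤x , ≤-refl

  ball-convex : ∀ {s u v w η} → u ≤ v → v ≤ w → ∣ s - u ∣ < η → ∣ s - w ∣ < η → ∣ s - v ∣ < η
  ball-convex u≤v v≤w su<η sw<η = ∣-∣<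
    (<-≤-trans (∣-∣<⇒<+ su<η) (u≤v ⊕ ≤-refl))
    (≤-<-trans v≤w (∣-∣<⇒<+′ sw<η))

  <-+ : ∀ {x ε} → 0# < ε → x < x + ε
  <-+ 0<ε = ≰⇒> λ x+ε≤x → <⇒≱ 0<ε (linear x+ε≤x (solve 2 (λ x ε → (x :+ ε :≤ x) ⊢ ε :≤ :0) ≈.refl _ _))

  ∣-∣<-ordered : ∀ {s t ε} → 0# < ε → s ≤ t → t < s + ε → ∣ s - t ∣ < ε
  ∣-∣<-ordered 0<ε s≤t = ∣-∣< (≤-<-trans s≤t (<-+ 0<ε))

  half< : ∀ {x ε} → 0# < ε → x + half ε < x + ε
  half< {x} {ε} 0<ε = ≰⇒> λ le → <⇒≱ (0<half 0<ε) (linear (le ⊕ ≤-reflexive (half+half ε))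
    (solve 3 (λ x h ε → (x :+ ε :≤ x :+ h) ⊞ (h :+ h :≤ ε) ⊢ h :≤ :0) ≈.refl _ _ _))

  -- `sup` takes predicates in the lowest universe only; `True` of a decision by excluded middle
  -- brings `P` down to it.
  supremum : ∀ {p} (P : Pred Carrier p) → ∃ P → ∀ b → (∀ x → P x → x ≤ b) →
             ∃[ s ] (∀ x → P x → x ≤ s) × (∀ u → (∀ x → P x → x ≤ u) → s ≤ u) ×
                    (∀ ε → 0# < ε → ∃[ x ] P x × s < x + ε)
  supremum P (x , Px) b bound
    with sup (λ x → True (em {P = P x})) (x , fromWitness Px) (b , λ x t → bound x (toWitness t))
  ... | s , upper , least = s , (λ x Px → upper x (fromWitness Px)) ,
      (λ u bound → least u (λ x t → bound x (toWitness t))) , approximate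
    where
    approximate : ∀ ε → 0# < ε → ∃[ x ] P x × s < x + ε
    -- Otherwise `s - ε` would be a smaller upper bound.
    approximate ε 0<ε = byContradiction λ none → <⇒≱ 0<ε
      (linear (least (s - ε) (λ x t → linear (x+ε≤s none (toWitness t) ⊕ ≤-reflexive (≈.sym (x+[y-x]≈y ε s)))
          (solve 4 (λ x ε s z → (x :+ ε :≤ s) ⊞ (s :≤ ε :+ z) ⊢ x :≤ z) ≈.refl _ _ _ _))
        ⊕ ≤-reflexive (x+[y-x]≈y ε s))
      (solve 3 (λ ε s z → (s :≤ z) ⊞ (ε :+ z :≤ s) ⊢ ε :≤ :0) ≈.refl _ _ _))
      where
      x+ε≤s : ¬ (∃[ x ] P x × s < x + ε) → ∀ {x} → P x → x + ε ≤ s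
      x+ε≤s none Px = ≮⇒≥ λ s<x+ε → none (_ , Px , s<x+ε)

  -- Connectedness of an interval, with `local` for local constancy. Close to the supremum `s` of
  -- the points with `P` there is such a point `u`. From `u`, `P` passes to `b` if `b` is close to
  -- `s`, and otherwise to `s + half η`, beyond the supremum.
  connected : ∀ {p a b} (a≤b : a ≤ b) (P : Pred (Interval a b) p) →
              (∀ s → ∃[ η ] 0# < η × (∀ u v → dist s u < η → dist s v < η → P u → P v)) →
              P (left a≤b) → P (right a≤b)
  connected {a = a} {b} a≤b P local Pa
    with supremum (λ u → ∃[ i ] P (u , i)) (a , _ , Pa) b (λ u ((_ , u≤b) , _) → u≤b)
  ... | s , upper , least , approximate with local (s , upper a (_ , Pa) , least b (λ u ((_ , u≤b) , _) → u≤b))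
  ... | η , 0<η , constant with approximate η 0<η
  ... | u , (i , Pu) , s<u+η = conclude em
    where
    v = s + half η
    a≤s = upper a (_ , Pa)
    s≤b = least b (λ u ((_ , u≤b) , _) → u≤b)
    s≤v : s ≤ v
    s≤v = proj₁ (<-+ (0<half 0<η))
    v<s+η : v < s + η
    v<s+η = half< 0<η
    u-near : ∣ s - u ∣ < η
    u-near = ≤-<-trans (≤-reflexive (∣-∣-sym s u)) (∣-∣<-ordered 0<η (upper u (i , Pu)) s<u+η)
    conclude : Dec (b < s + η) → P (right a≤b)
    conclude (yes b<s+η) = constant (u , i) (right a≤b) u-near (∣-∣<-ordered 0<η s≤b b<s+η) Pu
    conclude (no  b≮s+η) = contradiction
      (upper v (_ , constant (u , i) (v , ≤-trans a≤s s≤v , v≤b) u-near (∣-∣<-ordered 0<η s≤v v<s+η) Pu))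
      (<⇒≱ (<-+ (0<half 0<η)))
      where
      v≤b : v ≤ b
      v≤b = ≤-trans (proj₁ v<s+η) (≮⇒≥ b≮s+η)

-- Cyclic order on Fin n

-- k steps forward lead from i to j in ℤ/nℤ.
record _↝[_]_ {n} (i : Fin n) (k : ℕ) (j : Fin n) : Set where
  constructor _,_
  field
    turns    : ℕ
    equation : toℕ j ℕ.+ turns ℕ.* n ≡ k ℕ.+ toℕ i

Next⇒↝ : ∀ {n} {i j : Fin n} → Next i j → i ↝[ 1 ] j
Next⇒↝ {n@(ℕ.suc _)} {i} {j} i→j = ℕ.suc (toℕ i) / n ,
  ≡.trans (≡.cong (ℕ._+ (ℕ.suc (toℕ i) / n ℕ.* n)) (≡.sym i→j)) (≡.sym (m≡m%n+[m/n]*n (ℕ.suc (toℕ i)) n))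

↝-trans : ∀ {n k l} {h i j : Fin n} → h ↝[ k ] i → i ↝[ l ] j → h ↝[ l ℕ.+ k ] j
↝-trans {n} {k} {l} {h} {i} {j} (c , p) (c′ , q) = c ℕ.+ c′ , (begin
  toℕ j ℕ.+ (c ℕ.+ c′) ℕ.* n        ≡⟨ solve 4 (λ j c c′ n → j :+ (c :+ c′) :* n := (j :+ c′ :* n) :+ c :* n) refl
                                          (toℕ j) c c′ n ⟩
  toℕ j ℕ.+ c′ ℕ.* n ℕ.+ c ℕ.* n    ≡⟨ ≡.cong (ℕ._+ c ℕ.* n) q ⟩
  l ℕ.+ toℕ i ℕ.+ c ℕ.* n           ≡⟨ ℕ.+-assoc l (toℕ i) (c ℕ.* n) ⟩
  l ℕ.+ (toℕ i ℕ.+ c ℕ.* n)         ≡⟨ ≡.cong (l ℕ.+_) p ⟩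
  l ℕ.+ (k ℕ.+ toℕ h)               ≡⟨ ℕ.+-assoc l k (toℕ h) ⟨
  l ℕ.+ k ℕ.+ toℕ h                 ∎)
  where
  open +-*-Solver
  open ≡.≡-Reasoning

↝-return : ∀ {n k} {i : Fin n} → i ↝[ k ] i → n ∣ k
↝-return {n} {k} {i} (c , p) = divides c
  (ℕ.+-cancelʳ-≡ (toℕ i) k (c ℕ.* n) (≡.trans (≡.sym p) (ℕ.+-comm (toℕ i) (c ℕ.* n))))

Next-functional : ∀ {n} {i j k : Fin n} → Next i j → Next i k → j ≡ k
Next-functional i→j i→k = toℕ-injective (≡.trans (≡.sym i→j) i→k)

next : ∀ {n} (i : Fin n) → ∃ (Next i)
next {ℕ.suc n} i = fromℕ< (m%n<n (ℕ.suc (toℕ i)) (ℕ.suc n)) ,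
  ≡.sym (toℕ-fromℕ< (m%n<n (ℕ.suc (toℕ i)) (ℕ.suc n)))

previous : ∀ {n} (j : Fin n) → ∃[ i ] Next i j
previous {ℕ.suc n} zero = fromℕ n , ≡.trans (≡.cong (λ m → ℕ.suc m % ℕ.suc n) (toℕ-fromℕ n)) (n%n≡0 (ℕ.suc n))
previous {ℕ.suc n} (suc i) = inject₁ i ,
  ≡.trans (≡.cong (λ m → ℕ.suc m % ℕ.suc n) (toℕ-inject₁ i)) (m<n⇒m%n≡m (ℕ.s≤s (toℕ<n i)))

∤-small : ∀ {n k} .{{_ : ℕ.NonZero k}} → k ℕ.< n → n ∤ k
∤-small k<n n∣k = ℕ.<⇒≱ k<n (∣⇒≤ n∣k)

-- A coincidence closes up a walk of one step, so `n` would divide 1. The next three lemmas use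
-- closed walks of up to four steps.
Next-irrefl : ∀ {n} {i j : Fin n} → 2 ℕ.≤ n → Next i j → i ≢ j
Next-irrefl 2≤n i→j refl = ∤-small 2≤n (↝-return (Next⇒↝ i→j))

not-equal-after-two : ∀ {n} {h i j : Fin n} → 3 ℕ.≤ n → Next h i → Next i j → h ≢ j
not-equal-after-two 3≤n h→i i→j refl =
  ∤-small 3≤n (↝-return (↝-trans (Next⇒↝ h→i) (Next⇒↝ i→j)))

not-neighbours-after-two : ∀ {n} {h i j : Fin n} → 4 ℕ.≤ n → Next h i → Next i j → ¬ Neighbours h j
not-neighbours-after-two 4≤n h→i i→j (inj₁ h→j) with Next-functional h→i h→j
... | refl = ∤-small (ℕ.≤-trans (ℕ.s≤s (ℕ.s≤s ℕ.z≤n)) 4≤n) (↝-return (Next⇒↝ i→j))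
not-neighbours-after-two 4≤n h→i i→j (inj₂ j→h) =
  ∤-small 4≤n (↝-return (↝-trans (↝-trans (Next⇒↝ h→i) (Next⇒↝ i→j)) (Next⇒↝ j→h)))

not-neighbours-after-three : ∀ {n} {h i j k : Fin n} → 5 ℕ.≤ n → Next h i → Next i j → Next j k → ¬ Neighbours h k
not-neighbours-after-three 5≤n h→i i→j j→k (inj₁ h→k) with Next-functional h→i h→k
... | refl = not-equal-after-two (ℕ.≤-trans (ℕ.s≤s (ℕ.s≤s (ℕ.s≤s ℕ.z≤n))) 5≤n) i→j j→k refl
not-neighbours-after-three 5≤n h→i i→j j→k (inj₂ k→h) =
  ∤-small 5≤n (↝-return (↝-trans (↝-trans (↝-trans (Next⇒↝ h→i) (Next⇒↝ i→j)) (Next⇒↝ j→k)) (Next⇒↝ k→h)))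

odd⇒even-suc : ∀ m → 2 ∤ m → 2 ∣ ℕ.suc m
odd⇒even-suc ℕ.zero 2∤0 = contradiction (divides 0 refl) 2∤0
odd⇒even-suc (ℕ.suc ℕ.zero) _ = divides 1 refl
odd⇒even-suc (ℕ.suc (ℕ.suc m)) 2∤ =
  ∣m∣n⇒∣m+n (divides 1 refl) (odd⇒even-suc m (2∤ ∘ ∣m∣n⇒∣m+n (divides 1 refl)))

even⇒odd-suc : ∀ m → 2 ∣ m → 2 ∤ ℕ.suc m
even⇒odd-suc m 2∣m 2∣1+m with ∣1⇒≡1 (∣m+n∣m⇒∣n (≡.subst (2 ∣_) (ℕ.+-comm 1 m) 2∣1+m) 2∣m)
... | ()

module _ {n} {i j : Fin (2 ℕ.* n)} (i→j : Next i j) where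
  private
    open _↝[_]_ (Next⇒↝ i→j) renaming (turns to c)
    2∣c*2n : 2 ∣ c ℕ.* (2 ℕ.* n)
    2∣c*2n = ∣n⇒∣m*n c (divides n (ℕ.*-comm 2 n))

  -- Wrapping around subtracts a multiple of `2 * n`, which leaves the parity unchanged.
  Next-odd-even : Odd i → Even j
  Next-odd-even odd = ∣m+n∣m⇒∣n
    (≡.subst (2 ∣_) (≡.trans (≡.sym equation) (ℕ.+-comm (toℕ j) _)) (odd⇒even-suc _ odd))
    2∣c*2n

  Next-even-odd : Even i → Odd j
  Next-even-odd even even′ = even⇒odd-suc _ even (≡.subst (2 ∣_) equation (∣m∣n⇒∣m+n even′ 2∣c*2n))

-- In the ordering of Fin n, the last edge of the cycle is the pair (0 , n - 1).
CycleEdge : ℕ → ℕ → ℕ → Set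
CycleEdge n i j = ℕ.suc i ≡ j ⊎ (i ≡ 0 × ℕ.suc j ≡ n)

Neighbours⇔CycleEdge : ∀ {n} {i j : Fin n} → toℕ i ℕ.< toℕ j → Neighbours i j ⇔ CycleEdge n (toℕ i) (toℕ j)
Neighbours⇔CycleEdge {n@(ℕ.suc _)} {i} {j} i<j = mk⇔ to from
  where
  no-wrap : ℕ.suc (toℕ i) % n ≡ ℕ.suc (toℕ i)
  no-wrap = m<n⇒m%n≡m (ℕ.≤-<-trans i<j (toℕ<n j))
  to : Neighbours i j → CycleEdge n (toℕ i) (toℕ j)
  to (inj₁ i→j) = inj₁ (≡.trans (≡.sym no-wrap) i→j)
  to (inj₂ j→i) with ℕ.m≤n⇒m<n∨m≡n (toℕ<n j)
  ... | inj₂ 1+j≡n = inj₂ (≡.trans (≡.sym j→i) (≡.trans (≡.cong (_% n) 1+j≡n) (n%n≡0 n)) , 1+j≡n)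
  ... | inj₁ 1+j<n = contradiction
    (ℕ.<-trans i<j (ℕ.≤-reflexive (≡.trans (≡.sym (m<n⇒m%n≡m 1+j<n)) j→i)))
    (ℕ.<-irrefl refl)
  from : CycleEdge n (toℕ i) (toℕ j) → Neighbours i j
  from (inj₁ 1+i≡j) = inj₁ (≡.trans no-wrap 1+i≡j)
  from (inj₂ (i≡0 , 1+j≡n)) = inj₂ (≡.trans (≡.cong (_% n) 1+j≡n) (≡.trans (n%n≡0 n) (≡.sym i≡0)))

module Geometry (em : ∀ {ℓ} → ExcludedMiddle ℓ) (ℝ : CompleteOrderedField) {c ℓ} (X : MetricSpace ℝ c ℓ) where
  private
    module R = Reals em ℝ
    module X = MetricSpace X
    module ≈ = R.≈
    module ≈ˣ = Setoid X.setoid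
    module Geo {x y} (σ : Geodesic X x y) where
      open Geodesic σ public
      open Func γ public using (to; cong)
  open R using (_+_; _-_; 0#; ∣_∣; _≤_; _<_; Interval; intervalSetoid; dist; left; right;
    _⊕_; linear; solve; _:+_; _:=_; _:≤_; _⊞_; _⊢_; :0;
    ≤-trans; ≤-refl; ≤-reflexive; ≤-antisym; ≤-total; ≤-respˡ-≈; ≤-respʳ-≈; ≰⇒>; <⇒≱; ≮⇒≥; ≤-<-trans; <-≤-trans;
    byContradiction; half; 0<half; half+half; ∣-∣≤; s≤t⇒s+∣s-t∣≈t; ∣-∣-sym)
  open X using (d) renaming (_≈_ to _≈ˣ_; Carrier to Point)

  -- The four-point condition and unit ball graphs

  argmax : ∀ {p n} {P : Pred (Fin n) p} (f : Fin n → R.Carrier) → ∃ P →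
           ∃[ v ] P v × (∀ u → P u → f u ≤ f v)
  argmax {n = n} {P} f (w , Pw) = v , Extremum.argmax-all f Pw (all-filter P? (allFin n)) ,
    λ u Pu → List.lookup (Extremum.f[xs]≤f[argmax] {f = f} w xs) (∈-filter⁺ P? (∈-allFin u) Pu)
    where
    module Extremum = Extrema R.totalOrder
    P? = λ u → em {P = P u}
    xs = filter P? (allFin n)
    -- The seed `w` satisfies `P`, so the maximiser does, whether it is the seed or an entry of
    -- `xs`.
    v = Extremum.argmax f w xs

  -- Gromov's condition for 0-hyperbolicity, with the maximum of the two other pair sums written as
  -- a disjunction, so that each case is a linear hypothesis.
  FourPoint : Set c
  FourPoint = ∀ w x y z → d x z + d w y ≤ d w z + d x y ⊎ d x z + d w y ≤ d w x + d y z

  module _ {G H : Graph} (ball : IsUnitBallGraph X G) (copy : InducedCopy H G) where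
    open IsUnitBallGraph ball
    open InducedCopy copy renaming (edges to edges′)
    private module H = Graph H

    position : H.Vertex → Point
    position v = ρ (f v)

    edge⇒near : ∀ {u v} → u ≢ v → H.Edge u v → d (position u) (position v) ≤ δ
    edge⇒near {u} {v} u≢v = Equivalence.to (edges _ _ (u≢v ∘ injective)) ∘ Equivalence.to (edges′ u v)

    near⇒edge : ∀ {u v} → u ≢ v → d (position u) (position v) ≤ δ → H.Edge u v
    near⇒edge {u} {v} u≢v = Equivalence.from (edges′ u v) ∘ Equivalence.from (edges _ _ (u≢v ∘ injective))

  module _ (fourPoint : FourPoint) where

    -- In either case of the four-point condition for `r`, `u`, `v`, `w`, the term `d r v` on the
    -- left absorbs the distance from `r` on the right, and what remains there is at most `δ`.
    furthest-simplicial : ∀ {δ r u v w} → d r u ≤ d r v → d r w ≤ d r v →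
                          d u v ≤ δ → d v w ≤ δ → d u w ≤ δ
    furthest-simplicial {δ} {r} {u} {v} {w} ru≤rv rw≤rv uv≤δ vw≤δ with fourPoint r u v w
    ... | inj₁ h = linear (h ⊕ rw≤rv ⊕ uv≤δ)
      (solve 5 (λ uw rv rw uv δ → (uw :+ rv :≤ rw :+ uv) ⊞ (rw :≤ rv) ⊞ (uv :≤ δ) ⊢ uw :≤ δ) ≈.refl _ _ _ _ _)
    ... | inj₂ h = linear (h ⊕ ru≤rv ⊕ vw≤δ)
      (solve 5 (λ uw rv rw uv δ → (uw :+ rv :≤ rw :+ uv) ⊞ (rw :≤ rv) ⊞ (uv :≤ δ) ⊢ uw :≤ δ) ≈.refl _ _ _ _ _)

    -- The closed neighbourhoods of the neighbours of a vertex v furthest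
    -- from r are nested, in the order of their distance from r.
    furthest-simple : ∀ {δ r u v w x} → d r u ≤ d r w → d r x ≤ d r v →
                      d u v ≤ δ → d v w ≤ δ → d x w ≤ δ → d x u ≤ δ
    furthest-simple {δ} {r} {u} {v} {w} {x} ru≤rw rx≤rv uv≤δ vw≤δ xw≤δ with fourPoint r x v u
    ... | inj₂ h = linear (h ⊕ rx≤rv ⊕ ≤-trans (≤-reflexive (X.sym v u)) uv≤δ)
      (solve 5 (λ xu rv rx vu δ → (xu :+ rv :≤ rx :+ vu) ⊞ (rx :≤ rv) ⊞ (vu :≤ δ) ⊢ xu :≤ δ) ≈.refl _ _ _ _ _)
    -- The bound `h` involves `d x v`, about which nothing is assumed. A second instance, with `w`,
    -- bounds it in turn, and it cancels from the sum.
    ... | inj₁ h with fourPoint r x w v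
    ... | inj₁ h′ = linear (h ⊕ h′ ⊕ ru≤rw ⊕ xw≤δ)
      (solve 7 (λ xu rv ru xv rw xw δ →
          (xu :+ rv :≤ ru :+ xv) ⊞ (xv :+ rw :≤ rv :+ xw) ⊞ (ru :≤ rw) ⊞ (xw :≤ δ) ⊢ xu :≤ δ)
        ≈.refl _ _ _ _ _ _ _)
    ... | inj₂ h′ = linear (h ⊕ h′ ⊕ ru≤rw ⊕ rx≤rv ⊕ ≤-trans (≤-reflexive (X.sym w v)) vw≤δ)
      (solve 8 (λ xu rv ru xv rw rx wv δ →
          (xu :+ rv :≤ ru :+ xv) ⊞ (xv :+ rw :≤ rx :+ wv) ⊞ (ru :≤ rw) ⊞ (rx :≤ rv) ⊞ (wv :≤ δ) ⊢ xu :≤ δ)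
        ≈.refl _ _ _ _ _ _ _ _)

    module _ {G : Graph} (ball : IsUnitBallGraph X G) where
      open IsUnitBallGraph ball

      -- Rooted at the vertex `zero`, the two cycle neighbours of a furthest vertex would be
      -- adjacent.
      fourPoint⇒chordal : Chordal G
      fourPoint⇒chordal n@(ℕ.suc _) 4≤n copy
        with argmax (λ u → d (position ball copy zero) (position ball copy u)) (zero , tt)
      ... | v , _ , furthest with previous v | next v
      ... | u , u→v | w , v→w = not-neighbours-after-two 4≤n u→v v→w (proj₂ (near⇒edge ball copy u≢w
        (furthest-simplicial (furthest u tt) (furthest w tt)
          (edge⇒near ball copy u≢v (u≢v , inj₁ u→v)) (edge⇒near ball copy v≢w (v≢w , inj₁ v→w)))))
        where
        2≤n = ℕ.≤-trans (ℕ.s≤s (ℕ.s≤s ℕ.z≤n)) 4≤n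
        u≢v = Next-irrefl 2≤n u→v
        v≢w = Next-irrefl 2≤n v→w
        u≢w = not-equal-after-two (ℕ.≤-trans (ℕ.s≤s (ℕ.s≤s (ℕ.s≤s ℕ.z≤n))) 4≤n) u→v v→w

      -- Let `a`, `u`, `v`, `w`, `b` be consecutive with `v` a furthest odd vertex. Whichever of `u`
      -- and `w` is nearer to the root inherits the outer odd neighbour of the other one. That
      -- neighbour is three steps away, too far for an edge in a cycle of at least six vertices.
      fourPoint⇒sunFree : SunFree G
      fourPoint⇒sunFree n@(ℕ.suc _) 3≤n copy
        with argmax {P = Odd} (λ u → d (position ball copy zero) (position ball copy u)) next-odd
        where
        next-odd : ∃ Odd
        next-odd = let i , 0→i = next zero in i , Next-even-odd {n} 0→i (divides 0 refl)
      ... | v , odd-v , furthest with previous v | next v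
      ... | u , u→v | w , v→w with previous u | next w
      ... | a , a→u | b , w→b = nested (≤-total (dist-r u) (dist-r w))
        where
        dist-r : Fin (2 ℕ.* n) → R.Carrier
        dist-r u = d (position ball copy zero) (position ball copy u)

        6≤2n = ℕ.*-monoʳ-≤ 2 3≤n
        5≤2n = ℕ.≤-trans (ℕ.n≤1+n 5) 6≤2n
        even-u : Even u
        even-u = R.byContradiction λ odd-u → odd-v (Next-odd-even {n} u→v odd-u)
        even-w = Next-odd-even {n} v→w odd-v
        odd-a : Odd a
        odd-a even-a = Next-even-odd {n} a→u even-a even-u
        odd-b = Next-even-odd {n} w→b even-w

        odd≢even : ∀ {i j : Fin (2 ℕ.* n)} → Odd i → Even j → i ≢ j
        odd≢even odd even refl = odd even

        near : ∀ {i j} → Odd i → Even j → Neighbours i j → d (position ball copy i) (position ball copy j) ≤ δ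
        near odd even i~j = edge⇒near ball copy (odd≢even odd even) (odd-even odd even i~j)

        neighbours : ∀ {i j} → Odd i → Even j → d (position ball copy i) (position ball copy j) ≤ δ → Neighbours i j
        neighbours odd even i~j with near⇒edge ball copy (odd≢even odd even) i~j
        ... | even-even _ even′ _ = contradiction even′ odd
        ... | odd-even _ _ i~j = i~j
        ... | even-odd even′ _ _ = contradiction even′ odd

        near′ : ∀ {i j} → Even i → Odd j → Neighbours i j → d (position ball copy i) (position ball copy j) ≤ δ
        near′ even odd i~j = edge⇒near ball copy (≢-sym (odd≢even odd even)) (even-odd even odd i~j)

        nested : ¬ (dist-r u ≤ dist-r w ⊎ dist-r w ≤ dist-r u)
        nested (inj₁ ru≤rw) = not-neighbours-after-three 5≤2n u→v v→w w→b (swap (neighbours odd-b even-u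
          (furthest-simple ru≤rw (furthest b odd-b) (near′ even-u odd-v (inj₁ u→v)) (near odd-v even-w (inj₁ v→w))
            (near odd-b even-w (inj₂ w→b)))))
        nested (inj₂ rw≤ru) = not-neighbours-after-three 5≤2n a→u u→v v→w (neighbours odd-a even-w
          (furthest-simple rw≤ru (furthest a odd-a) (near′ even-w odd-v (inj₂ v→w)) (near odd-v even-u (inj₂ u→v))
            (near odd-a even-u (inj₁ a→u))))

  -- Geodesics and arcs

  equal⇒≤0 : ∀ {x y} → x ≈ˣ y → d x y ≤ 0#
  equal⇒≤0 = ≤-reflexive ∘ X.≈⇒0

  ≤0⇒equal : ∀ {x y} → d x y ≤ 0# → x ≈ˣ y
  ≤0⇒equal d≤0 = X.0⇒≈ (≤-antisym d≤0 X.nonNegative)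

  image : ∀ {a b} → intervalSetoid a b ⟶ₛ X.setoid → Pred Point ℓ
  image f p = ∃[ t ] Func.to f t ≈ˣ p

  module _ {a b} (f : intervalSetoid a b ⟶ₛ X.setoid) where
    open Func f

    -- Shortness gives continuity with `η = ε`. Inverse continuity contains injectivity: equal
    -- images of parameters at positive distance would contradict it for that distance as `ε`.
    short-embedding : (∀ s t → d (to s) (to t) ≤ dist s t) →
      (∀ s ε → 0# < ε → ∃[ η ] 0# < η × (∀ t → d (to s) (to t) < η → dist s t < ε)) →
      IsEmbedding X f
    short-embedding short inverseContinuous = record
      { injective = injective
      ; continuous = λ s ε 0<ε → ε , 0<ε , λ t → ≤-<-trans (short s t)
      ; inverseContinuous = inverseContinuous
      }
      where
      injective : ∀ s t → to s ≈ˣ to t → proj₁ s R.≈ proj₁ t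
      injective s t fs≈ft = R.∣-∣≤0⇒≈ dist≤0
        where
        dist≤0 : dist s t ≤ 0#
        dist≤0 = byContradiction λ dist≰0 → case inverseContinuous s (dist s t) (≰⇒> dist≰0) of λ where
          (η , 0<η , close) → <⇒≱ (close t (≤-<-trans (equal⇒≤0 fs≈ft) 0<η)) ≤-refl

  module _ {x y : Point} (σ : Geodesic X x y) where
    open Geo σ

    ordered-dist : ∀ {s t} → proj₁ s ≤ proj₁ t → proj₁ s + d (to s) (to t) R.≈ proj₁ t
    ordered-dist s≤t = ≈.trans (R.+-congˡ (distancePreserving _ _)) (s≤t⇒s+∣s-t∣≈t s≤t)

    dist-from-start : ∀ t → d x (to t) R.≈ proj₁ t
    dist-from-start t = ≈.trans (≈.trans (X.cong (≈ˣ.sym start) ≈ˣ.refl) (≈.sym (R.+-identityˡ _)))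
      (ordered-dist {left X.nonNegative} {t} (proj₁ (proj₂ t)))

    dist-to-end : ∀ t → proj₁ t + d (to t) y R.≈ d x y
    dist-to-end t = ≈.trans (R.+-congˡ (X.cong ≈ˣ.refl (≈ˣ.sym end)))
      (ordered-dist {t} {right X.nonNegative} (proj₂ (proj₂ t)))

    -- The ends are free up to `≈ˣ`, so that geodesics with equivalent ends become arcs between the
    -- same two points.
    geodesic-isArc : ∀ {x′ y′} → x ≈ˣ x′ → y ≈ˣ y′ → IsArc X x′ y′ (image γ)
    geodesic-isArc x≈x′ y≈y′ = record
      { a≤b = X.nonNegative
      ; f = γ
      ; isEmbedding = short-embedding γ (λ s t → ≤-reflexive (distancePreserving s t))
          (λ s ε 0<ε → ε , 0<ε , λ t → ≤-<-trans (≤-reflexive (≈.sym (distancePreserving s t))))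
      ; start = ≈ˣ.trans start x≈x′
      ; end = ≈ˣ.trans end y≈y′
      ; isImage = id , id
      }

    initial : ∀ t → Geodesic X x (to t)
    initial t = record
      { γ = record { to = λ s → to (include s) ; cong = cong }
      ; distancePreserving = λ s s′ → distancePreserving (include s) (include s′)
      ; start = ≈ˣ.trans (cong ≈.refl) start
      ; end = cong (dist-from-start t)
      }
      where
      include : Interval 0# (d x (to t)) → Interval 0# (d x y)
      include (s , 0≤s , s≤) = s , 0≤s , ≤-trans s≤ (≤-respˡ-≈ (≈.sym (dist-from-start t)) (proj₂ (proj₂ t)))

    final : ∀ t → Geodesic X (to t) y
    final t = record
      { γ = record { to = λ s → to (shift s) ; cong = λ s≈s′ → cong (R.+-congˡ s≈s′) }
      ; distancePreserving = λ s s′ → ≈.trans (distancePreserving (shift s) (shift s′))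
          (R.∣-∣-cong (solve 3 (λ t s s′ → t :+ s :+ s′ := t :+ s′ :+ s) ≈.refl _ _ _))
      ; start = cong (R.+-identityʳ _)
      ; end = ≈ˣ.trans (cong (dist-to-end t)) end
      }
      where
      shift : Interval 0# (d (to t) y) → Interval 0# (d x y)
      shift (s , 0≤s , s≤) = proj₁ t + s ,
        linear (proj₁ (proj₂ t) ⊕ 0≤s) (solve 2 (λ t s → (:0 :≤ t) ⊞ (:0 :≤ s) ⊢ :0 :≤ t :+ s) ≈.refl _ _) ,
        ≤-trans (≤-refl ⊕ s≤) (≤-reflexive (dist-to-end t))

  -- The last common point of two geodesics

  module _ {w x y : Point} (α : Geodesic X w x) (β : Geodesic X w y) where
    private
      module α = Geo α
      module β = Geo β

    -- Only equal parameters are compared: the parameter of a point is its distance from `w`, the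
    -- same on both geodesics.
    record LastMeeting : Set ℓ where
      field
        time    : R.Carrier
        inˡ     : 0# ≤ time × time ≤ d w x
        inʳ     : 0# ≤ time × time ≤ d w y
        meeting : α.to (time , inˡ) ≈ˣ β.to (time , inʳ)
        last    : ∀ s t → proj₁ s R.≈ proj₁ t → α.to s ≈ˣ β.to t → proj₁ s ≤ time

    private
      Meeting : Pred R.Carrier ℓ
      Meeting t = ∃[ p ] ∃[ q ] α.to (t , p) ≈ˣ β.to (t , q)

      start-meeting : Meeting 0#
      start-meeting = (≤-refl , X.nonNegative) , (≤-refl , X.nonNegative) ,
        ≈ˣ.trans (≈ˣ.trans (α.cong ≈.refl) α.start) (≈ˣ.trans (≈ˣ.sym β.start) (β.cong ≈.refl))

    -- The supremum `s` of the meeting times is itself one: a meeting at time `t` puts the points of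
    -- `α` and `β` at time `s` within `2(s - t)` of each other, and `t` can be chosen arbitrarily
    -- close to `s`.
    lastMeeting : LastMeeting
    lastMeeting = record
      { time = s ; inˡ = p ; inʳ = q ; meeting = meeting
      ; last = λ u v u≈v αu≈βv → upper _ (proj₂ u ,
          (≤-respʳ-≈ (≈.sym u≈v) (proj₁ (proj₂ v)) , ≤-respˡ-≈ (≈.sym u≈v) (proj₂ (proj₂ v))) ,
          ≈ˣ.trans αu≈βv (β.cong (≈.sym u≈v)))
      }
      where
      supremum = R.supremum Meeting (0# , start-meeting) (d w x) (λ t ((_ , t≤) , _) → t≤)
      s = proj₁ supremum
      upper = proj₁ (proj₂ supremum)
      least = proj₁ (proj₂ (proj₂ supremum))
      approximate = proj₂ (proj₂ (proj₂ supremum))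
      p = upper 0# start-meeting , least (d w x) (λ t ((_ , t≤) , _) → t≤)
      q = upper 0# start-meeting , least (d w y) (λ t (_ , (_ , t≤) , _) → t≤)
      meeting : α.to (s , p) ≈ˣ β.to (s , q)
      meeting = ≤0⇒equal (byContradiction λ e≰0 → let e>0 = ≰⇒> e≰0 in
        case approximate _ (R.0<half e>0) of λ where
          (t , (p′ , q′ , αt≈βt) , s<t+h) → let t≤s = upper t (p′ , q′ , αt≈βt) in
            <⇒≱ s<t+h (closer
              (X.triangle (α.to (s , p)) (α.to (t , p′)) (β.to (s , q)))
              (≤-reflexive (X.sym (α.to (s , p)) (α.to (t , p′))))
              (≤-reflexive (ordered-dist α {t , p′} {s , p} t≤s))
              (≤-reflexive (X.cong αt≈βt ≈ˣ.refl))
              (≤-reflexive (ordered-dist β {t , q′} {s , q} t≤s))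
              (proj₁ s<t+h) (≤-reflexive (R.half+half _))))
        where
        closer : ∀ {s t e h ts st m m′} → e ≤ st + m → st ≤ ts → t + ts ≤ s → m ≤ m′ → t + m′ ≤ s →
                 s ≤ t + h → h + h ≤ e → t + h ≤ s
        closer h₁ h₂ h₃ h₄ h₅ h₆ h₇ = linear (h₁ ⊕ h₂ ⊕ h₃ ⊕ h₄ ⊕ h₅ ⊕ h₆ ⊕ h₇)
          (solve 8 (λ s t e h ts st m m′ → (e :≤ st :+ m) ⊞ (st :≤ ts) ⊞ (t :+ ts :≤ s) ⊞ (m :≤ m′) ⊞
              (t :+ m′ :≤ s) ⊞ (s :≤ t :+ h) ⊞ (h :+ h :≤ e) ⊢ t :+ h :≤ s) ≈.refl _ _ _ _ _ _ _ _)

  -- Concatenation of two geodesics at their common start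

  Separated : ∀ {p q x y} → Geodesic X p x → Geodesic X q y → Set
  Separated σ τ = ∀ s → 0# < proj₁ s → ∃[ e ] 0# < e × (∀ t → e ≤ d (Geo.to σ s) (Geo.to τ t))

  module _ {p q x y : Point} (p≈q : p ≈ˣ q) (σ : Geodesic X p x) (τ : Geodesic X q y)
           (sep : Separated σ τ) (sep′ : Separated τ σ) where
    private
      module σ = Geo σ
      module τ = Geo τ
      L = d p x
      M = d q y

    -- At u z: at time u, the path that runs from x to p along σ and on to
    -- y along τ is at z.
    data At (u : R.Carrier) : Point → Set ℓ where
      before : ∀ v → u + proj₁ v R.≈ L → At u (σ.to v)
      after  : ∀ v → L + proj₁ v R.≈ u → At u (τ.to v)

    locate : (u : Interval 0# (L + M)) → ∃ (At (proj₁ u))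
    locate (u , 0≤u , u≤L+M) with ≤-total u L
    ... | inj₁ u≤L = _ , before (L - u ,
        linear (u≤L ⊕ ≤-reflexive (≈.sym (R.x+[y-x]≈y u L)))
          (solve 3 (λ u L v → (u :≤ L) ⊞ (L :≤ u :+ v) ⊢ :0 :≤ v) ≈.refl _ _ _) ,
        linear (0≤u ⊕ ≤-reflexive (R.x+[y-x]≈y u L))
          (solve 3 (λ u L v → (:0 :≤ u) ⊞ (u :+ v :≤ L) ⊢ v :≤ L) ≈.refl _ _ _))
      (R.x+[y-x]≈y u L)
    ... | inj₂ L≤u = _ , after (u - L ,
        linear (L≤u ⊕ ≤-reflexive (≈.sym (R.x+[y-x]≈y L u)))
          (solve 3 (λ u L v → (u :≤ L) ⊞ (L :≤ u :+ v) ⊢ :0 :≤ v) ≈.refl _ _ _) ,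
        linear (u≤L+M ⊕ ≤-reflexive (R.x+[y-x]≈y L u))
          (solve 4 (λ u L v M → (u :≤ L :+ M) ⊞ (L :+ v :≤ u) ⊢ v :≤ M) ≈.refl _ _ _ _))
      (R.x+[y-x]≈y L u)

    across : ∀ v w → d (σ.to v) (τ.to w) ≤ proj₁ v + proj₁ w
    across v w = linear (X.triangle (σ.to v) p (τ.to w)
        ⊕ ≤-reflexive (≈.trans (X.sym _ _) (dist-from-start σ v))
        ⊕ ≤-reflexive (≈.trans (X.cong p≈q ≈ˣ.refl) (dist-from-start τ w)))
      (solve 5 (λ a b c v w → (a :≤ b :+ c) ⊞ (b :≤ v) ⊞ (c :≤ w) ⊢ a :≤ v :+ w) ≈.refl _ _ _ _ _)

    acrossˡ : ∀ v w → proj₁ w ≤ proj₁ v + d (σ.to v) (τ.to w)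
    acrossˡ v w = linear (X.triangle p (σ.to v) (τ.to w) ⊕ ≤-reflexive (dist-from-start σ v)
        ⊕ ≤-reflexive (≈.trans (≈.sym (dist-from-start τ w)) (X.cong (≈ˣ.sym p≈q) ≈ˣ.refl)))
      (solve 5 (λ a b c v w → (a :≤ b :+ c) ⊞ (b :≤ v) ⊞ (w :≤ a) ⊢ w :≤ v :+ c) ≈.refl _ _ _ _ _)

    acrossʳ : ∀ v w → proj₁ v ≤ proj₁ w + d (σ.to v) (τ.to w)
    acrossʳ v w = linear (X.triangle p (τ.to w) (σ.to v)
        ⊕ ≤-reflexive (≈.trans (X.cong p≈q ≈ˣ.refl) (dist-from-start τ w))
        ⊕ ≤-reflexive (≈.sym (dist-from-start σ v)) ⊕ ≤-reflexive (X.sym _ _))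
      (solve 6 (λ a b c c′ v w → (a :≤ b :+ c) ⊞ (b :≤ w) ⊞ (v :≤ a) ⊞ (c :≤ c′) ⊢ v :≤ w :+ c′) ≈.refl _ _ _ _ _ _)

    before-isometric : ∀ {u u′} v v′ → u + proj₁ v R.≈ L → u′ + proj₁ v′ R.≈ L →
                       d (σ.to v) (σ.to v′) R.≈ ∣ u - u′ ∣
    before-isometric v v′ e e′ = ≈.trans (σ.distancePreserving v v′) (≈.trans (R.∣-∣-cong (≈.trans (R.+-comm _ _)
      (≈.trans e (≈.trans (≈.sym e′) (R.+-comm _ _))))) (∣-∣-sym _ _))

    after-isometric : ∀ {u u′} v v′ → L + proj₁ v R.≈ u → L + proj₁ v′ R.≈ u′ →
                      d (τ.to v) (τ.to v′) R.≈ ∣ u - u′ ∣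
    after-isometric v v′ e e′ = ≈.trans (τ.distancePreserving v v′) (R.∣-∣-cong
      (≈.trans (R.+-congˡ (≈.sym e′))
        (≈.trans (solve 3 (λ L v v′ → v :+ (L :+ v′) := v′ :+ (L :+ v)) ≈.refl L _ _) (R.+-congˡ e))))

    gap : ∀ {u u′} v w → u + v R.≈ L → L + w R.≈ u′ → u + (v + w) R.≈ u′
    gap v w e e′ = ≈.trans (≈.sym (R.+-assoc _ v w)) (≈.trans (R.+-congʳ e) e′)

    -- Each half is isometric. Across the junction the elapsed time is `v + w`, the length of the
    -- way through `p`.
    short : ∀ {u u′ z z′} → At u z → At u′ z′ → d z z′ ≤ ∣ u - u′ ∣
    short (before v e) (before v′ e′) = ≤-reflexive (before-isometric v v′ e e′)
    short (after v e) (after v′ e′) = ≤-reflexive (after-isometric v v′ e e′)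
    short {u} {u′} (before v e) (after w e′) = linear
      (across v w ⊕ R.≤+∣-∣′ u u′ ⊕ ≤-reflexive (gap (proj₁ v) (proj₁ w) e e′))
      (solve 6 (λ u u′ a v w b → (b :≤ v :+ w) ⊞ (u′ :≤ u :+ a) ⊞ (u :+ (v :+ w) :≤ u′) ⊢ b :≤ a) ≈.refl _ _ _ _ _ _)
    short {u} {u′} (after w e′) (before v e) = ≤-trans (≤-reflexive (X.sym _ _)) (linear
      (across v w ⊕ R.≤+∣-∣ u u′ ⊕ ≤-reflexive (gap (proj₁ v) (proj₁ w) e e′))
      (solve 6 (λ u u′ a v w b → (b :≤ v :+ w) ⊞ (u′ :≤ u :+ a) ⊞ (u :+ (v :+ w) :≤ u′) ⊢ b :≤ a) ≈.refl _ _ _ _ _ _))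

    -- Follows from `short` at time difference zero; in particular the two constructors agree at the
    -- junction, so the choice made by `locate` does not matter.
    At-cong : ∀ {u u′ z z′} → At u z → At u′ z′ → u R.≈ u′ → z ≈ˣ z′
    At-cong {u} {u′} at at′ u≈u′ = ≤0⇒equal (≤-trans (short at at′) (∣-∣≤
      (≤-trans (≤-reflexive u≈u′) (≤-reflexive (≈.sym (R.+-identityʳ _))))
      (≤-trans (≤-reflexive (≈.sym u≈u′)) (≤-reflexive (≈.sym (R.+-identityʳ _))))))

    concatenation : intervalSetoid 0# (L + M) ⟶ₛ X.setoid
    concatenation = record
      { to = λ u → proj₁ (locate u)
      ; cong = λ {u} {u′} → At-cong (proj₂ (locate u)) (proj₂ (locate u′))
      }

    ∣-∣≤-across : ∀ {u u′ v w} → u + v R.≈ L → L + w R.≈ u′ → 0# ≤ v → 0# ≤ w →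
                  ∀ {r} → v + w ≤ r → ∣ u - u′ ∣ ≤ r
    ∣-∣≤-across {v = v} {w} e e′ 0≤v 0≤w v+w≤r = ∣-∣≤
      (linear (≤-reflexive (gap v w e e′) ⊕ 0≤v ⊕ 0≤w ⊕ 0≤v ⊕ 0≤w ⊕ v+w≤r)
        (solve 5 (λ u u′ v w r → (u :+ (v :+ w) :≤ u′) ⊞ (:0 :≤ v) ⊞ (:0 :≤ w) ⊞ (:0 :≤ v) ⊞ (:0 :≤ w) ⊞
            (v :+ w :≤ r) ⊢ u :≤ u′ :+ r) ≈.refl _ _ _ _ _))
      (linear (≤-reflexive (≈.sym (gap v w e e′)) ⊕ v+w≤r)
        (solve 5 (λ u u′ v w r → (u′ :≤ u :+ (v :+ w)) ⊞ (v :+ w :≤ r) ⊢ u′ :≤ u :+ r) ≈.refl _ _ _ _ _))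

    -- Inverse continuity. Away from the junction, `sep` or `sep′` gives a radius within which the
    -- other half does not come. At the junction, the distance to a point of the other half is at
    -- least the elapsed time.
    expanding : ∀ {u z} → At u z → ∀ ε → 0# < ε →
                ∃[ η ] 0# < η × (∀ {u′ z′} → At u′ z′ → d z z′ < η → ∣ u - u′ ∣ < ε)
    expanding {u} (before v e) ε 0<ε = case em of λ where
      (yes 0<v) → case sep v 0<v of λ where
        (e₀ , 0<e₀ , e₀≤) → case R.minimum 0<ε 0<e₀ of λ where
          (η , 0<η , η≤ε , η≤e₀) → η , 0<η , λ where
            (before v′ e′) near → ≤-<-trans (≤-reflexive (≈.sym (before-isometric v v′ e e′))) (<-≤-trans near η≤ε)
            (after w e′) near → contradiction (≤-trans η≤e₀ (e₀≤ w)) (<⇒≱ near)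
      (no 0≮v) → ε , 0<ε , λ where
        (before v′ e′) near → ≤-<-trans (≤-reflexive (≈.sym (before-isometric v v′ e e′))) near
        (after w e′) near → ≤-<-trans (∣-∣≤-across e e′ (proj₁ (proj₂ v)) (proj₁ (proj₂ w))
          (linear (acrossˡ v w ⊕ ≮⇒≥ 0≮v ⊕ ≮⇒≥ 0≮v)
            (solve 3 (λ v w a → (w :≤ v :+ a) ⊞ (v :≤ :0) ⊞ (v :≤ :0) ⊢ v :+ w :≤ a) ≈.refl _ _ _))) near
    expanding {u} (after w e′) ε 0<ε = case em of λ where
      (yes 0<w) → case sep′ w 0<w of λ where
        (e₀ , 0<e₀ , e₀≤) → case R.minimum 0<ε 0<e₀ of λ where
          (η , 0<η , η≤ε , η≤e₀) → η , 0<η , λ where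
            (after v′ e) near → ≤-<-trans (≤-reflexive (≈.sym (after-isometric w v′ e′ e))) (<-≤-trans near η≤ε)
            (before v e) near → contradiction (≤-trans η≤e₀ (e₀≤ v)) (<⇒≱ near)
      (no 0≮w) → ε , 0<ε , λ where
        (after v′ e) near → ≤-<-trans (≤-reflexive (≈.sym (after-isometric w v′ e′ e))) near
        (before v e) near → ≤-<-trans (≤-reflexive (∣-∣-sym _ _)) (≤-<-trans
          (∣-∣≤-across e e′ (proj₁ (proj₂ v)) (proj₁ (proj₂ w))
            (linear (acrossʳ v w ⊕ ≮⇒≥ 0≮w ⊕ ≮⇒≥ 0≮w)
              (solve 3 (λ v w a → (w :≤ v :+ a) ⊞ (v :≤ :0) ⊞ (v :≤ :0) ⊢ w :+ v :≤ a) ≈.refl _ _ _)))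
          (≤-<-trans (≤-reflexive (X.sym _ _)) near))

    private
      0≤L+M : 0# ≤ L + M
      0≤L+M = linear (X.nonNegative {p} {x} ⊕ X.nonNegative {q} {y})
        (solve 2 (λ a b → (:0 :≤ a) ⊞ (:0 :≤ b) ⊢ :0 :≤ a :+ b) ≈.refl _ _)

      L-inside : Interval 0# (L + M)
      L-inside = L , X.nonNegative , linear (X.nonNegative {q} {y})
        (solve 2 (λ a b → (:0 :≤ b) ⊢ a :≤ a :+ b) ≈.refl _ _)

    concatenation-isArc : IsArc X x y (image concatenation)
    concatenation-isArc = record
      { a≤b = 0≤L+M
      ; f = concatenation
      ; isEmbedding = short-embedding concatenation (λ s t → short (proj₂ (locate s)) (proj₂ (locate t)))
          (λ s ε 0<ε → case expanding (proj₂ (locate s)) ε 0<ε of λ where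
            (η , 0<η , near) → η , 0<η , λ t → near (proj₂ (locate t)))
      ; start = ≈ˣ.trans (At-cong (proj₂ (locate (left 0≤L+M))) (before (right X.nonNegative) (R.+-identityˡ _)) ≈.refl) σ.end
      ; end = ≈ˣ.trans (At-cong (proj₂ (locate (right 0≤L+M))) (after (right X.nonNegative) ≈.refl) ≈.refl) τ.end
      ; isImage = id , id
      }

    -- Where arcs are unique, this puts the branching point on the geodesic from `x` to `y`.
    junction∈concatenation : image concatenation p
    junction∈concatenation = L-inside ,
      ≈ˣ.trans (At-cong (proj₂ (locate L-inside)) (before (left X.nonNegative) (R.+-identityʳ _)) ≈.refl) σ.start

  -- Separation after the last meeting

  module _ {w x y : Point} (α : Geodesic X w x) (β : Geodesic X w y) where
    private
      module α = Geo α
      module β = Geo β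

    radial≤ : ∀ u v → ∣ proj₁ u - proj₁ v ∣ ≤ d (α.to u) (β.to v)
    radial≤ u v = ∣-∣≤
      (linear (X.triangle w (β.to v) (α.to u) ⊕ ≤-reflexive (≈.sym (dist-from-start α u))
          ⊕ ≤-reflexive (dist-from-start β v) ⊕ ≤-reflexive (X.sym (β.to v) (α.to u)))
        (solve 6 (λ a b c e u v → (a :≤ b :+ c) ⊞ (u :≤ a) ⊞ (b :≤ v) ⊞ (c :≤ e) ⊢ u :≤ v :+ e) ≈.refl _ _ _ _ _ _))
      (linear (X.triangle w (α.to u) (β.to v) ⊕ ≤-reflexive (≈.sym (dist-from-start β v)) ⊕ ≤-reflexive (dist-from-start α u))
        (solve 5 (λ a b c u v → (a :≤ b :+ c) ⊞ (u :≤ a) ⊞ (b :≤ v) ⊢ u :≤ v :+ c) ≈.refl _ _ _ _ _))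

    -- The distance from α u to β v is at least ∣ u - v ∣, and at least
    -- d (α u) (β u) - ∣ u - v ∣, hence at least half of d (α u) (β u).
    separated-at : ∀ u → (∀ v → proj₁ u R.≈ proj₁ v → ¬ (α.to u ≈ˣ β.to v)) →
                   ∃[ e ] 0# < e × (∀ v → e ≤ d (α.to u) (β.to v))
    separated-at u apart = conclude em
      where
      conclude : Dec (proj₁ u ≤ d w y) → ∃[ e ] 0# < e × (∀ v → e ≤ d (α.to u) (β.to v))
      conclude (yes u≤) = half e , 0<half 0<e , λ v → case ≤-total (half e) (d (α.to u) (β.to v)) of λ where
          (inj₁ h≤) → h≤
          (inj₂ ≤h) → linear (X.triangle (α.to u) (β.to v) (β.to u′) ⊕ ≤-reflexive (β.distancePreserving v u′)
            ⊕ ≤-reflexive (∣-∣-sym (proj₁ v) (proj₁ u)) ⊕ radial≤ u v ⊕ ≤h ⊕ ≤-reflexive (half+half e))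
            (solve 6 (λ e b c c′ a h →
                (e :≤ a :+ b) ⊞ (b :≤ c) ⊞ (c :≤ c′) ⊞ (c′ :≤ a) ⊞ (a :≤ h) ⊞ (h :+ h :≤ e) ⊢ h :≤ a)
              ≈.refl _ _ _ _ _ _)
        where
        u′ : Interval 0# (d w y)
        u′ = proj₁ u , proj₁ (proj₂ u) , u≤
        e = d (α.to u) (β.to u′)
        0<e : 0# < e
        0<e = ≰⇒> (apart u′ ≈.refl ∘ ≤0⇒equal)
      -- Here `β` ends before time `u`, so the difference of the distances from `w` alone keeps all
      -- of `β` away.
      conclude (no u≰) = proj₁ u - d w y ,
        ≰⇒> (λ e≤0 → u≰ (linear (e≤0 ⊕ ≤-reflexive (≈.sym (R.x+[y-x]≈y (d w y) (proj₁ u))))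
          (solve 3 (λ e b u → (e :≤ :0) ⊞ (u :≤ b :+ e) ⊢ u :≤ b) ≈.refl _ _ _))) ,
        λ v → linear (radial≤ u v ⊕ R.≤+∣-∣ (proj₁ u) (proj₁ v)
            ⊕ ≤-reflexive (R.x+[y-x]≈y (d w y) (proj₁ u)) ⊕ proj₂ (proj₂ v))
          (solve 6 (λ e b u v z a → (z :≤ a) ⊞ (u :≤ v :+ z) ⊞ (b :+ e :≤ u) ⊞ (v :≤ b) ⊢ e :≤ a) ≈.refl _ _ _ _ _ _)

    -- The field `last` excludes meetings at later times, as `separated-at` requires.
    separated-after : (m : LastMeeting α β) → let open LastMeeting m in
                      Separated (final α (time , inˡ)) (final β (time , inʳ))
    separated-after m s 0<s = case separated-at (time + proj₁ s , _)
      (λ v u≈v meet → <⇒≱ 0<s (linear (last (time + proj₁ s , _) v u≈v meet)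
        (solve 2 (λ t s → (t :+ s :≤ t) ⊢ s :≤ :0) ≈.refl _ _))) of λ where
        (e , 0<e , e≤) → e , 0<e , λ t → e≤ (time + proj₁ t , _)
      where open LastMeeting m

  flip : ∀ {w x y} {α : Geodesic X w x} {β : Geodesic X w y} → LastMeeting α β → LastMeeting β α
  flip m = record
    { time = time ; inˡ = inʳ ; inʳ = inˡ ; meeting = ≈ˣ.sym meeting
    ; last = λ s t s≈t βs≈αt → ≤-trans (≤-reflexive s≈t) (last t s (≈.sym s≈t) (≈ˣ.sym βs≈αt))
    }
    where open LastMeeting m

  -- Unique arcs imply the four-point condition

  module _ (geodesic : IsGeodesicSpace X) (uniqueArc : IsUniquelyArcConnected X) where

    arcs-agree : ∀ {x y A B} → IsArc X x y A → IsArc X x y B → ∀ {p} → A p → B p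
    arcs-agree {x} {y} arcA arcB = proj₁ (unique arcB) ∘ proj₂ (unique arcA)
      where unique = proj₂ (proj₂ (uniqueArc x y))

    -- The images agree as arcs, and the position of a point on either geodesic is its distance from
    -- the start.
    geodesics-agree : ∀ {x y x′ y′} (σ : Geodesic X x y) (τ : Geodesic X x′ y′) → x ≈ˣ x′ → y ≈ˣ y′ →
                      ∀ s t → proj₁ s R.≈ proj₁ t → Geo.to σ s ≈ˣ Geo.to τ t
    geodesics-agree σ τ x≈x′ y≈y′ s t s≈t
      with arcs-agree (geodesic-isArc σ x≈x′ y≈y′) (geodesic-isArc τ ≈ˣ.refl ≈ˣ.refl) (s , ≈ˣ.refl)
    ... | t′ , τt′≈σs = ≈ˣ.trans (≈ˣ.sym τt′≈σs) (Geo.cong τ (≈.trans (≈.sym (dist-from-start τ t′))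
      (≈.trans (X.cong (≈ˣ.sym x≈x′) τt′≈σs) (≈.trans (dist-from-start σ s) s≈t))))

    module _ (w x y : Point) where
      private
        α = geodesic w x
        β = geodesic w y
      open LastMeeting (lastMeeting α β)

      -- The initial segments up to the last meeting are geodesics with equivalent ends.
      agree-before : ∀ s t → proj₁ s R.≈ proj₁ t → proj₁ s ≤ time → Geo.to α s ≈ˣ Geo.to β t
      agree-before (s , 0≤s , _) (t , 0≤t , _) s≈t s≤time =
        ≈ˣ.trans (Geo.cong α ≈.refl) (≈ˣ.trans
          (geodesics-agree (initial α (time , inˡ)) (initial β (time , inʳ)) ≈ˣ.refl meeting
            (s , 0≤s , ≤-respʳ-≈ (≈.sym (dist-from-start α (time , inˡ))) s≤time)
            (t , 0≤t , ≤-respʳ-≈ (≈.sym (dist-from-start β (time , inʳ))) (≤-respˡ-≈ s≈t s≤time))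
            s≈t)
          (Geo.cong β ≈.refl))

      -- The final segments form an arc from `x` to `y`, so the branching point lies on the geodesic
      -- between them. In other words, the Gromov product of `x` and `y` at `w` is at most `time`.
      branching-time : d w x + d w y ≤ time + time + d x y
      branching-time = linear
        (≤-reflexive (≈.sym (dist-to-end α (time , inˡ))) ⊕ ≤-reflexive (≈.sym (dist-to-end β (time , inʳ)))
          ⊕ ≤-reflexive (X.cong (≈ˣ.sym (≈ˣ.trans σt≈p meeting)) ≈ˣ.refl)
          ⊕ ≤-reflexive (≈.trans (X.sym _ _) (X.cong ≈ˣ.refl (≈ˣ.sym σt≈p)))
          ⊕ ≤-reflexive (dist-from-start (geodesic x y) t) ⊕ ≤-reflexive (dist-to-end (geodesic x y) t))
        (solve 9 (λ wx wy xy m px py q u z →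
            (wx :≤ m :+ px) ⊞ (wy :≤ m :+ py) ⊞ (py :≤ q) ⊞ (px :≤ z) ⊞ (z :≤ u) ⊞ (u :+ q :≤ xy)
          ⊢ wx :+ wy :≤ m :+ m :+ xy) ≈.refl _ _ _ _ _ _ _ _ _)
        where
        junction∈geodesic : image (Geodesic.γ (geodesic x y)) (Geo.to α (time , inˡ))
        junction∈geodesic = arcs-agree
          (concatenation-isArc meeting (final α (time , inˡ)) (final β (time , inʳ))
            (separated-after α β (lastMeeting α β)) (separated-after β α (flip (lastMeeting α β))))
          (geodesic-isArc (geodesic x y) ≈ˣ.refl ≈ˣ.refl)
          (junction∈concatenation meeting (final α (time , inˡ)) (final β (time , inʳ))
            (separated-after α β (lastMeeting α β)) (separated-after β α (flip (lastMeeting α β))))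
        t = proj₁ junction∈geodesic
        σt≈p = proj₂ junction∈geodesic

    -- The triangle inequality through the common point: the Gromov product of `x` and `z` at `w` is
    -- at least its parameter.
    common-point : ∀ w x z s t → proj₁ s R.≈ proj₁ t → Geo.to (geodesic w x) s ≈ˣ Geo.to (geodesic w z) t →
                   d x z + proj₁ s + proj₁ s ≤ d w x + d w z
    common-point w x z s t s≈t αs≈βt = linear
      (X.triangle x (Geo.to (geodesic w x) s) z ⊕ ≤-reflexive (X.sym _ _) ⊕ ≤-reflexive (X.cong αs≈βt ≈ˣ.refl)
        ⊕ ≤-reflexive (dist-to-end (geodesic w x) s) ⊕ ≤-reflexive (dist-to-end (geodesic w z) t) ⊕ ≤-reflexive s≈t)
      (solve 9 (λ xz wx wz a b c e s t →
          (xz :≤ a :+ b) ⊞ (a :≤ c) ⊞ (b :≤ e) ⊞ (s :+ c :≤ wx) ⊞ (t :+ e :≤ wz) ⊞ (s :≤ t)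
        ⊢ xz :+ s :+ s :≤ wx :+ wz) ≈.refl _ _ _ _ _ _ _ _ _)

    -- Up to the earlier of the two branching times, the geodesics to `x` and to `z` both follow the
    -- one to `y`. So the Gromov product of `x` and `z` at `w` is at least the smaller of those of
    -- `x`, `y` and of `y`, `z`.
    uniqueArcs⇒fourPoint : FourPoint
    uniqueArcs⇒fourPoint w x y z = case ≤-total M₁.time M₂.time of λ where
        (inj₁ t₁≤t₂) → inj₁ (linear
          (common-point w x z (M₁.time , M₁.inˡ) (M₁.time , proj₁ M₁.inˡ , ≤-trans t₁≤t₂ (proj₂ M₂.inʳ)) ≈.refl
              (≈ˣ.trans (agree-before w x y _ _ ≈.refl ≤-refl) (agree-before w y z (M₁.time , M₁.inʳ) _ ≈.refl t₁≤t₂))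
            ⊕ branching-time w x y)
          (solve 6 (λ xz t wx wz wy xy →
              (xz :+ t :+ t :≤ wx :+ wz) ⊞ (wx :+ wy :≤ t :+ t :+ xy) ⊢ xz :+ wy :≤ wz :+ xy)
            ≈.refl _ _ _ _ _ _))
        (inj₂ t₂≤t₁) → inj₂ (linear
          (common-point w x z (M₂.time , proj₁ M₂.inˡ , ≤-trans t₂≤t₁ (proj₂ M₁.inˡ)) (M₂.time , M₂.inʳ) ≈.refl
              (≈ˣ.trans (agree-before w x y _ (M₂.time , M₂.inˡ) ≈.refl t₂≤t₁) (agree-before w y z _ _ ≈.refl ≤-refl))
            ⊕ branching-time w y z)
          (solve 6 (λ xz t wx wz wy yz →
              (xz :+ t :+ t :≤ wx :+ wz) ⊞ (wy :+ wz :≤ t :+ t :+ yz) ⊢ xz :+ wy :≤ wx :+ yz)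
            ≈.refl _ _ _ _ _ _))
      where
      module M₁ = LastMeeting (lastMeeting (geodesic w x) (geodesic w y))
      module M₂ = LastMeeting (lastMeeting (geodesic w y) (geodesic w z))

  -- Induced cycles around a point

  -- Both ends are required to be far, which makes the relation symmetric and chains reversible.
  FarStep : R.Carrier → Point → Rel Point 0ℓ
  FarStep δ m p q = ¬ (d m p ≤ δ) × ¬ (d m q ≤ δ) × d p q ≤ δ

  farStep-sym : ∀ {δ m p q} → FarStep δ m p q → FarStep δ m q p
  farStep-sym (p-far , q-far , near) = q-far , p-far , ≤-trans (≤-reflexive (X.sym _ _)) near

  module _ (chordal : ∀ G → IsUnitBallGraph X G → Chordal G) {δ : R.Carrier} (0<δ : 0# < δ) where

    Near : Point → Point → Set
    Near p q = d p q ≤ δ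

    near-sym : ∀ {p q} → Near p q → Near q p
    near-sym = ≤-trans (≤-reflexive (X.sym _ _))

    -- The indices are the vertices of a unit ball graph realized by `ρ`. Both adjacencies are
    -- symmetric, so pairs with `i` before `j` suffice.
    no-induced-cycle : ∀ {n} → 4 ℕ.≤ n → (ρ : Fin n → Point) →
      ¬ (∀ i j → toℕ i ℕ.< toℕ j → Near (ρ i) (ρ j) ⇔ CycleEdge n (toℕ i) (toℕ j))
    no-induced-cycle {n} 4≤n ρ near⇔ = chordal G ball n 4≤n
      (record { f = id ; injective = id ; edges = λ i j → mk⇔ (to i j) (from i j) })
      where
      G : Graph
      G = record
        { order = n
        ; Edge = λ i j → i ≢ j × Near (ρ i) (ρ j)
        ; symm = λ (i≢j , near) → ≢-sym i≢j , near-sym near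
        ; irrefl = λ i≡j (i≢j , _) → i≢j i≡j
        }
      ball : IsUnitBallGraph X G
      ball = record { δ = δ ; 0<δ = 0<δ ; ρ = ρ ; edges = λ i j i≢j → mk⇔ proj₂ (i≢j ,_) }
      to : ∀ i j → Graph.Edge (cycle n) i j → Graph.Edge G i j
      to i j (i≢j , i~j) with ℕ.<-cmp (toℕ i) (toℕ j)
      ... | tri< i<j _ _ = i≢j , Equivalence.from (near⇔ i j i<j) (Equivalence.to (Neighbours⇔CycleEdge i<j) i~j)
      ... | tri≈ _ i≡j _ = contradiction (toℕ-injective i≡j) i≢j
      ... | tri> _ _ j<i = i≢j , near-sym
        (Equivalence.from (near⇔ j i j<i) (Equivalence.to (Neighbours⇔CycleEdge j<i) (swap i~j)))
      from : ∀ i j → Graph.Edge G i j → Graph.Edge (cycle n) i j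
      from i j (i≢j , near) with ℕ.<-cmp (toℕ i) (toℕ j)
      ... | tri< i<j _ _ = i≢j , Equivalence.from (Neighbours⇔CycleEdge i<j) (Equivalence.to (near⇔ i j i<j) near)
      ... | tri≈ _ i≡j _ = contradiction (toℕ-injective i≡j) i≢j
      ... | tri> _ _ j<i = i≢j , swap
        (Equivalence.from (Neighbours⇔CycleEdge j<i) (Equivalence.to (near⇔ j i j<i) (near-sym near)))

    ¬Any⇒All : ∀ {p n} {P : Pred Point p} (vs : Vec Point n) → ¬ Any P vs → All (¬_ ∘ P) vs
    ¬Any⇒All [] _ = []
    ¬Any⇒All (v ∷ vs) none = (none ∘ here) ∷ ¬Any⇒All vs (none ∘ there)

    module _ (m : Point) where

      Far : Point → Set
      Far p = ¬ Near m p

      -- Induced paths to q all of whose vertices but q are far from m.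
      data Induced (q : Point) : ∀ {n} → Vec Point (ℕ.suc n) → Set c where
        single : Induced q (q ∷ [])
        link   : ∀ {n p r} {vs : Vec Point n} → Far p → Near p r → All (¬_ ∘ Near p) vs →
                 Induced q (r ∷ vs) → Induced q (p ∷ r ∷ vs)

      -- An induced path starting with `p`, where `p` may be close to `m`: the cycle through `m`
      -- will close up there.
      record Extension (q p : Point) : Set c where
        constructor extension
        field
          {n}      : ℕ
          r        : Point
          vs       : Vec Point n
          near     : Near p r
          far      : All (¬_ ∘ Near p) vs
          induced  : Induced q (r ∷ vs)

      -- A path is prolonged by p at its last vertex near p.
      extend : ∀ {n q p} {vs : Vec Point (ℕ.suc n)} → Induced q vs → Any (Near p) vs → Extension q p
      extend {q = q} single (here near) = extension q [] near [] single
      extend {p = p} (link {r = r} {vs} far near none path) any with em {P = Any (Near p) (r ∷ vs)}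
      ... | yes later = extend path later
      ... | no ¬later with any
      ... | here near′ = extension _ (r ∷ vs) near′ (¬Any⇒All (r ∷ vs) ¬later) (link far near none path)
      ... | there later = contradiction later ¬later

      IsPath : ∀ {n} → Vec Point n → Set
      IsPath vs = ∀ i j → toℕ i ℕ.< toℕ j → Near (lookup vs i) (lookup vs j) ⇔ ℕ.suc (toℕ i) ≡ toℕ j

      cons-isPath : ∀ {n p r} {vs : Vec Point n} → Near p r → All (¬_ ∘ Near p) vs →
                    IsPath (r ∷ vs) → IsPath (p ∷ r ∷ vs)
      cons-isPath near far path zero (suc zero) _ = mk⇔ (λ _ → refl) (λ _ → near)
      cons-isPath near far path zero (suc (suc j)) _ = mk⇔ (λ near′ → contradiction near′ (lookup⁺ far j)) (λ ())
      cons-isPath near far path (suc i) (suc j) (ℕ.s≤s i<j) = mk⇔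
        (≡.cong ℕ.suc ∘ Equivalence.to (path i j i<j)) (Equivalence.from (path i j i<j) ∘ ℕ.suc-injective)

      induced-isPath : ∀ {n q} {vs : Vec Point (ℕ.suc n)} → Induced q vs → IsPath vs
      induced-isPath single zero zero ()
      induced-isPath (link _ near far path) = cons-isPath near far (induced-isPath path)

      only-end-near : ∀ {n q} {vs : Vec Point (ℕ.suc n)} → Near m q → Induced q vs →
                      ∀ i → Near m (lookup vs i) ⇔ toℕ i ≡ n
      only-end-near near single zero = mk⇔ (λ _ → refl) (λ _ → near)
      only-end-near near (link far _ _ _) zero = mk⇔ (λ near′ → contradiction near′ far) (λ ())
      only-end-near near (link _ _ _ path) (suc i) = mk⇔
        (≡.cong ℕ.suc ∘ Equivalence.to (only-end-near near path i))
        (Equivalence.from (only-end-near near path i) ∘ ℕ.suc-injective)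

      -- On the path from `p` to `q` only the two ends are near `m`, so `m` closes it to an induced
      -- cycle. As `p` is not near `q`, the path has a further vertex and the cycle has length at
      -- least 4.
      no-loop : ∀ {p q} → Near m p → Near m q → ¬ Near p q → ¬ Extension q p
      no-loop {p} {q} mp mq ¬pq (extension {n} r vs near far path) =
        no-induced-cycle (4≤ path near) (lookup (m ∷ p ∷ r ∷ vs)) adjacent
        where
        4≤ : ∀ {n r} {vs : Vec Point n} → Induced q (r ∷ vs) → Near p r → 4 ℕ.≤ 3 ℕ.+ n
        4≤ single pq = contradiction pq ¬pq
        4≤ (link _ _ _ _) _ = ℕ.s≤s (ℕ.s≤s (ℕ.s≤s (ℕ.s≤s ℕ.z≤n)))
        adjacent : ∀ i j → toℕ i ℕ.< toℕ j →
                   Near (lookup (m ∷ p ∷ r ∷ vs) i) (lookup (m ∷ p ∷ r ∷ vs) j) ⇔ CycleEdge (3 ℕ.+ n) (toℕ i) (toℕ j)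
        adjacent zero (suc zero) _ = mk⇔ (λ _ → inj₁ refl) (λ _ → mp)
        adjacent zero (suc (suc k)) _ = mk⇔
          (λ near → inj₂ (refl , ≡.cong (3 ℕ.+_) (Equivalence.to (only-end-near mq path k) near)))
          (λ { (inj₂ (_ , eq)) → Equivalence.from (only-end-near mq path k) (ℕ.+-cancelˡ-≡ 3 _ _ eq) })
        adjacent (suc i) (suc j) (ℕ.s≤s i<j) = mk⇔
          (inj₁ ∘ ≡.cong ℕ.suc ∘ Equivalence.to (cons-isPath near far (induced-isPath path) i j i<j))
          (λ { (inj₁ eq) → Equivalence.from (cons-isPath near far (induced-isPath path) i j i<j) (ℕ.suc-injective eq)
             ; (inj₂ (() , _)) })

      trace : ∀ {p q z} → Star (FarStep δ m) p z → Near z q → Extension q p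
      trace stop near = extend single (here near)
      trace ((_ , far , near) ◅ chain) z~q = case trace chain z~q of λ where
        (extension r vs near′ none path) → extend (link far near′ none path) (here near)

      no-detour : ∀ {p r q s} → Near m p → Near p r → Far r → Star (FarStep δ m) r s →
                  Near s q → Near m q → Near p q
      no-detour mp pr r-far chain sq mq = byContradiction λ ¬pq → no-loop mp mq ¬pq (case trace chain sq of λ where
        (extension _ _ near none path) → extend (link r-far near none path) (here pr))

  -- Continuous paths and a point off them

  Continuous : ∀ {a b} → intervalSetoid a b ⟶ₛ X.setoid → Set
  Continuous f = ∀ s ε → 0# < ε → ∃[ η ] 0# < η × (∀ t → dist s t < η → d (Func.to f s) (Func.to f t) < ε)

  module _ {a b} (a≤b : a ≤ b) (f : intervalSetoid a b ⟶ₛ X.setoid) (continuous : Continuous f) where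
    open Func f

    -- Connectedness replaces compactness: having a positive bound up to `u` is locally constant in
    -- `u`, because around `s` the path keeps at least half of the distance from `m` to its point at
    -- `s`.
    distance-to-image : ∀ {m} → ¬ image f m → ∃[ ε ] 0# < ε × (∀ s → ε ≤ d m (to s))
    distance-to-image {m} m∉ = case R.connected a≤b P local (d m (to (left a≤b)) , 0<dist (left a≤b) ,
        λ v v≤a → ≤-reflexive (X.cong ≈ˣ.refl (cong (≤-antisym (proj₁ (proj₂ v)) v≤a)))) of λ where
        (ε , 0<ε , bound) → ε , 0<ε , λ s → bound s (proj₂ (proj₂ s))
      where
      P : Interval a b → Set
      P u = ∃[ ε ] 0# < ε × (∀ v → proj₁ v ≤ proj₁ u → ε ≤ d m (to v))

      0<dist : ∀ s → 0# < d m (to s)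
      0<dist s = ≰⇒> λ d≤0 → m∉ (s , ≈ˣ.sym (≤0⇒equal d≤0))

      local : ∀ s → ∃[ η ] 0# < η × (∀ u v → dist s u < η → dist s v < η → P u → P v)
      local s = case continuous s h (0<half (0<dist s)) of λ where
          (η , 0<η , close) → η , 0<η , λ u v su<η sv<η → λ where
            (ε , 0<ε , bound) → case R.minimum 0<ε (0<half (0<dist s)) of λ where
              (ε′ , 0<ε′ , ε′≤ε , ε′≤h) → ε′ , 0<ε′ , λ w w≤v → case ≤-total (proj₁ w) (proj₁ u) of λ where
                (inj₁ w≤u) → ≤-trans ε′≤ε (bound w w≤u)
                (inj₂ u≤w) → ≤-trans ε′≤h (away w (proj₁ (close w (R.ball-convex u≤w w≤v su<η sv<η))))
        where
        h = half (d m (to s))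
        away : ∀ w → d (to s) (to w) ≤ h → h ≤ d m (to w)
        away w near = linear
          (X.triangle m (to w) (to s) ⊕ ≤-reflexive (X.sym (to w) (to s)) ⊕ near ⊕ ≤-reflexive (half+half _))
          (solve 5 (λ a b c c′ h → (a :≤ b :+ c) ⊞ (c :≤ c′) ⊞ (c′ :≤ h) ⊞ (h :+ h :≤ a) ⊢ h :≤ b) ≈.refl _ _ _ _ _)

    -- Being reached by a chain is locally constant in the parameter: between parameters close to
    -- `s` the chain steps through the point at `s`.
    chain-along : ∀ {δ m} → 0# < δ → (∀ s → ¬ d m (to s) ≤ δ) →
                  Star (FarStep δ m) (to (left a≤b)) (to (right a≤b))
    chain-along {δ} 0<δ far = R.connected a≤b (λ u → Star _ (to (left a≤b)) (to u)) (λ s → case continuous s δ 0<δ of λ where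
      (η , 0<η , close) → η , 0<η , λ u v su<η sv<η chain →
        chain ◅◅ (far u , far s , ≤-trans (≤-reflexive (X.sym (to u) (to s))) (proj₁ (close u su<η)))
              ◅ (far s , far v , proj₁ (close v sv<η)) ◅ stop) stop

  -- Chordality implies unique arcs

  module _ (chordal : ∀ G → IsUnitBallGraph X G → Chordal G) (geodesic : IsGeodesicSpace X) where

    -- Stations on the geodesic from `m` to `z`: `p` at distance `δ` from `m`, and `r` at distance
    -- `2δ`, from where the chain follows the rest.
    record Spoke (δ : R.Carrier) (m z : Point) : Set c where
      field
        {p r}  : Point
        m~p    : d m p ≤ δ
        p-on   : δ + d p z ≤ d m z
        p~r    : d p r ≤ δ
        r-far  : ¬ (d m r ≤ δ)
        chain  : Star (FarStep δ m) r z

    spoke : ∀ {δ m z} → 0# < δ → δ + δ ≤ d m z → Spoke δ m z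
    spoke {δ} {m} {z} 0<δ 2δ≤ = record
      { m~p = ≤-reflexive (dist-from-start β δᵢ)
      ; p-on = ≤-reflexive (dist-to-end β δᵢ)
      ; p~r = linear (≤-reflexive (ordered-dist β {δᵢ} {2δᵢ} δ≤2δ))
          (solve 2 (λ δ a → (δ :+ a :≤ δ :+ δ) ⊢ a :≤ δ) ≈.refl _ _)
      ; r-far = far 2δᵢ ≤-refl
      -- `beyond` starts at `r` and ends at `z` only up to `≈ˣ`; steps of length zero at both ends
      -- bridge this.
      ; chain = (far 2δᵢ ≤-refl , beyond-far (left X.nonNegative) , ≤-trans (equal⇒≤0 (≈ˣ.sym beyond.start)) (proj₁ 0<δ))
          ◅ chain-along X.nonNegative beyond.γ
              (IsEmbedding.continuous (IsArc.isEmbedding (geodesic-isArc beyond ≈ˣ.refl ≈ˣ.refl))) 0<δ beyond-far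
          ◅◅ (beyond-far (right X.nonNegative) , z-far , ≤-trans (equal⇒≤0 beyond.end) (proj₁ 0<δ)) ◅ stop
      }
      where
      β = geodesic m z
      module β = Geo β
      δ≤2δ : δ ≤ δ + δ
      δ≤2δ = proj₁ (R.<-+ 0<δ)
      2δ≰δ : ¬ (δ + δ ≤ δ)
      2δ≰δ = <⇒≱ (R.<-+ 0<δ)
      δᵢ 2δᵢ : Interval 0# (d m z)
      δᵢ = δ , proj₁ 0<δ , ≤-trans δ≤2δ 2δ≤
      2δᵢ = δ + δ , ≤-trans (proj₁ 0<δ) δ≤2δ , 2δ≤
      beyond = final β 2δᵢ
      module beyond = Geo beyond
      z-far : ¬ (d m z ≤ δ)
      z-far = 2δ≰δ ∘ ≤-trans 2δ≤
      far : ∀ t → δ + δ ≤ proj₁ t → ¬ (d m (β.to t) ≤ δ)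
      far t 2δ≤t d≤δ = 2δ≰δ (≤-trans 2δ≤t (≤-trans (≤-reflexive (≈.sym (dist-from-start β t))) d≤δ))
      beyond-far : ∀ s → ¬ (d m (beyond.to s) ≤ δ)
      beyond-far s = far (δ + δ + proj₁ s , _)
        (linear (proj₁ (proj₂ s)) (solve 2 (λ t s → (:0 :≤ s) ⊢ t :≤ t :+ s) ≈.refl _ _))

    -- If the path misses `m`, then `no-detour` puts the points at distance `δ` from `m` on the two
    -- spokes within `δ` of each other. Going over them shortens the way from `x` to `y` through `m`
    -- by at least `δ`, although that way is already shortest.
    crossing : ∀ {x y m a b} (a≤b : a ≤ b) (f : intervalSetoid a b ⟶ₛ X.setoid) → Continuous f →
               Func.to f (left a≤b) ≈ˣ x → Func.to f (right a≤b) ≈ˣ y → d x m + d m y ≤ d x y → image f m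
    crossing {x} {y} {m} a≤b f continuous start end between = byContradiction λ m∉ →
      case distance-to-image a≤b f continuous m∉ of λ where
        (ε , 0<ε , ε≤) → let
          -- Then the path is at distance at least `2δ` from `m`, as `spoke` requires of its ends.
          δ = half ε
          0<δ : 0# < δ
          0<δ = 0<half 0<ε
          2δ≤_ : ∀ s → δ + δ ≤ d m (Func.to f s)
          2δ≤_ = λ s → ≤-trans (≤-reflexive (half+half ε)) (ε≤ s)
          far : ∀ s → ¬ (d m (Func.to f s) ≤ δ)
          far s = λ d≤δ → <⇒≱ (R.<-+ 0<δ) (≤-trans (2δ≤ s) d≤δ)
          sx = spoke 0<δ (2δ≤ left a≤b)
          sy = spoke 0<δ (2δ≤ right a≤b)
          module x = Spoke sx
          module y = Spoke sy
          p~q : d x.p y.p ≤ δ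
          p~q = no-detour chordal 0<δ m x.m~p x.p~r x.r-far
            (x.chain ◅◅ chain-along a≤b f continuous 0<δ far ◅◅ reverse farStep-sym y.chain)
            (≤-trans (≤-reflexive (X.sym y.r y.p)) y.p~r) y.m~p
          in <⇒≱ 0<δ (linear
            (X.triangle x′ x.p y′ ⊕ X.triangle x.p y.p y′ ⊕ p~q ⊕ x.p-on ⊕ y.p-on ⊕ ≤-reflexive (X.sym x′ x.p) ⊕ between′)
            (solve 9 (λ δ xy xp py pq qy px mx my → (xy :≤ xp :+ py) ⊞ (py :≤ pq :+ qy) ⊞ (pq :≤ δ) ⊞ (δ :+ px :≤ mx)
              ⊞ (δ :+ qy :≤ my) ⊞ (xp :≤ px) ⊞ (mx :+ my :≤ xy) ⊢ δ :≤ :0) ≈.refl _ _ _ _ _ _ _ _ _))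
      where
      -- The chains join the values of `f` themselves, which are `x` and `y` only up to `≈ˣ`.
      x′ = Func.to f (left a≤b)
      y′ = Func.to f (right a≤b)
      between′ : d m x′ + d m y′ ≤ d x′ y′
      between′ = ≤-trans (≤-reflexive (R.+-cong (≈.trans (X.sym m x′) (X.cong start ≈ˣ.refl)) (X.cong ≈ˣ.refl end)))
        (≤-trans between (≤-reflexive (X.cong (≈ˣ.sym start) (≈ˣ.sym end))))

    module _ {x y : Point} {A : Pred Point ℓ} (arc : IsArc X x y A) where
      open IsArc arc
      open IsEmbedding isEmbedding
      private
        module f = Func f
        γ = geodesic x y
        module γ = Geo γ

      geodesic⊆arc : ∀ t → image f (γ.to t)
      geodesic⊆arc t = crossing a≤b f continuous start end
        (≤-trans (≤-reflexive (dist-from-start γ t) ⊕ ≤-refl) (≤-reflexive (dist-to-end γ t)))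

      -- If f s is off the geodesic γ, then the parameter τ t of γ t on the
      -- arc, continuous in t, stays below s.
      arc⊆geodesic : ∀ s → image γ.γ (f.to s)
      -- If `b ≤ s`, then `f s` is the end `y` of the arc, which lies on the geodesic after all.
      arc⊆geodesic s = byContradiction λ s∉ → s∉ (right X.nonNegative , ≈ˣ.trans γ.end (≈ˣ.trans (≈ˣ.sym end)
          (f.cong (≤-antisym (≤-trans (proj₂ (proj₂ (right a≤b))) (b≤s s∉)) (proj₂ (proj₂ s))))))
        where
        τ : ∀ t → Interval a b
        τ t = proj₁ (geodesic⊆arc t)
        fτ : ∀ t → f.to (τ t) ≈ˣ γ.to t
        fτ t = proj₂ (geodesic⊆arc t)
        P : Interval 0# (d x y) → Set
        P t = proj₁ (τ t) ≤ proj₁ s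
        b≤s : ¬ image γ.γ (f.to s) → b ≤ proj₁ s
        b≤s s∉ = ≤-respˡ-≈ (injective (τ (right X.nonNegative)) (right a≤b)
            (≈ˣ.trans (fτ _) (≈ˣ.trans γ.end (≈ˣ.sym end))))
          (R.connected X.nonNegative P local
            (≤-respˡ-≈ (injective (left a≤b) (τ (left X.nonNegative))
                (≈ˣ.sym (≈ˣ.trans (fτ _) (≈ˣ.trans γ.start (≈ˣ.sym start)))))
              (proj₁ (proj₂ s))))
          where
          local : ∀ t → ∃[ η ] 0# < η × (∀ u v → dist t u < η → dist t v < η → P u → P v)
          -- Inverse continuity of `f` makes `τ` continuous. The tolerance is the distance from
          -- `τ t` to `s`, positive since `f s` is off the geodesic, so nearby values of `τ` stay on
          -- the same side of `s`.
          local t = case inverseContinuous (τ t) (dist (τ t) s) 0<dist of λ where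
              (η , 0<η , close) → η , 0<η , λ u v tu<η tv<η τu≤s →
                same-side (R.∣-∣-cases (proj₁ (τ t)) (proj₁ s))
                  (close (τ u) (near u tu<η)) (close (τ v) (near v tv<η)) τu≤s
            where
            0<dist : 0# < dist (τ t) s
            0<dist = ≰⇒> λ d≤0 → s∉ (t , ≈ˣ.trans (≈ˣ.sym (fτ t)) (f.cong (R.∣-∣≤0⇒≈ d≤0)))
            near : ∀ {η} u → dist t u < η → d (f.to (τ t)) (f.to (τ u)) < η
            near u tu<η = ≤-<-trans (≤-reflexive (≈.trans (X.cong (fτ t) (fτ u)) (γ.distancePreserving t u))) tu<η
            same-side : ∀ {t s u v} → (s ≤ t × s + ∣ t - s ∣ R.≈ t) ⊎ (t ≤ s × t + ∣ t - s ∣ R.≈ s) →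
                        ∣ t - u ∣ < ∣ t - s ∣ → ∣ t - v ∣ < ∣ t - s ∣ → u ≤ s → v ≤ s
            same-side (inj₂ (_ , eq)) tu tv u≤s = proj₁ (<-≤-trans (R.∣-∣<⇒<+′ tv) (≤-reflexive eq))
            same-side (inj₁ (_ , eq)) tu tv u≤s = contradiction
              (≤-trans (u≤s ⊕ ≤-refl) (≤-reflexive eq)) (<⇒≱ (R.∣-∣<⇒<+ tu))

    chordal⇒uniqueArcs : IsUniquelyArcConnected X
    chordal⇒uniqueArcs x y =
      image (Geodesic.γ (geodesic x y)) , geodesic-isArc (geodesic x y) ≈ˣ.refl ≈ˣ.refl , λ arc →
      (λ (t , γt≈p) → proj₂ (IsArc.isImage arc) (let s , fs≈γt = geodesic⊆arc arc t in s , ≈ˣ.trans fs≈γt γt≈p)) ,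
      (λ p∈A → let s , fs≈p = proj₁ (IsArc.isImage arc) p∈A ; t , γt≈fs = arc⊆geodesic arc s in t , ≈ˣ.trans γt≈fs fs≈p)

-- The equivalence of the three conditions

theorem1p9 : (∀ {ℓ} → ExcludedMiddle ℓ) →
    ∀ (ℝ : CompleteOrderedField) {c ℓ} (X : MetricSpace ℝ c ℓ) →
    IsGeodesicSpace X →
    ((∀ G → IsUnitBallGraph X G → StronglyChordal G) ⇔ (∀ G → IsUnitBallGraph X G → Chordal G)) ×
    ((∀ G → IsUnitBallGraph X G → Chordal G) ⇔ IsRTree X)
theorem1p9 em ℝ X geodesic =
    mk⇔ (λ strong G ball → proj₁ (strong G ball))
        -- Chordality yields strong chordality by way of unique arcs.
        (λ chordal → uniqueArcs⇒stronglyChordal (chordal⇒uniqueArcs chordal geodesic))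
  , mk⇔ (λ chordal → geodesic , chordal⇒uniqueArcs chordal geodesic)
        (λ (_ , uniqueArc) G ball → proj₁ (uniqueArcs⇒stronglyChordal uniqueArc G ball))
  where
  open Geometry em ℝ X
  uniqueArcs⇒stronglyChordal : IsUniquelyArcConnected X → ∀ G → IsUnitBallGraph X G → StronglyChordal G
  uniqueArcs⇒stronglyChordal uniqueArc G ball = fourPoint⇒chordal fourPoint ball , fourPoint⇒sunFree fourPoint ball
    where fourPoint = uniqueArcs⇒fourPoint geodesic uniqueArc
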